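{- Let $B\ge 1$ and $m\ge 2$ be integers and let $1=\alpha_1\le\alpha_2\le\cdots\le\alpha_m=\alpha$ be real numbers. In the egress queue scheduling problem with $m$ queues of buffer size $B$ and priority values $\alpha_1,\dots,\alpha_m$, no deterministic online algorithm can achieve a competitive ratio smaller than $$1+\frac{\alpha^3+\alpha^2+\alpha}{\alpha^4+4\alpha^3+3\alpha^2+4\alpha+1}.$$
   Context: Egress queue scheduling problem. There are $m$ FIFO queues $Q^{(1)},\dots,Q^{(m)}$, each able to store at most $B$ unit-size packets simultaneously, all initially empty. Every packet has one of the values $\alpha_1,\dots,\alpha_m$; a packet arriving at $Q^{(i)}$ has value $\alpha_i$. An input is a finite sequence of events. At an arrival event, one packet arrives at one specified queue; it is accepted (stored at the tail) if that queue currently holds fewer than $B$ packets, and rejected (lost) otherwise. At a scheduling event, an algorithm selects one of its non-empty queues (if its buffers are not all empty) and transmits the packet at the head of that queue; thus only work-conserving algorithms, i.e. those transmitting a packet at a scheduling event whenever their buffers are not all empty, are considered. Every input is assumed to contain enough scheduling events for every algorithm to transmit all the packets it stores. The gain $V_{ALG}(\sigma)$ of an algorithm $ALG$ on input $\sigma$ is the sum of the values of the packets it transmits. A deterministic online algorithm makes each decision as a deterministic function of the events so far. $OPT$ denotes an optimal offline algorithm, i.e. one that, knowing the whole input $\sigma$, attains the maximum gain $V_{OPT}(\sigma)$. $ALG$ is $c$-competitive if $V_{ALG}(\sigma)\ge V_{OPT}(\sigma)/c$ for every input $\sigma$; its competitive ratio is the infimum of all such $c$. -}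

module Defs where

open import Algebra.Bundles using (RawSemiring)
import Algebra.Definitions.RawSemiring as RawSemiringOps
open import Data.Bool using (if_then_else_)
open import Data.Fin using (Fin; zero; fromℕ)
import Data.Fin as Fin
open import Data.Integer using (+_)
open import Data.List using (List; []; _∷_)
open import Data.Nat using (ℕ; suc)
import Data.Nat as ℕ
import Data.Nat.Properties as ℕ
open import Data.Product using (Σ; _×_; _,_; ∃-syntax; proj₁; proj₂)
open import Data.Rational using (ℚ; 0ℚ; 1ℚ; ½; ∣_∣; 1/_; _⊔_)
import Data.Rational as ℚ
import Data.Rational.Properties as ℚ
open import Data.Rational.Solver using (module +-*-Solver)
open import Data.Vec using (Vec; lookup; replicate; _[_]%=_)
open import Data.Sum using (inj₁; inj₂)
open import Level using (0ℓ)
open import Relation.Binary.PropositionalEquality using (_≡_; refl; sym; trans; cong; cong₂; subst)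
open import Relation.Nullary using (¬_; contradiction; does)
open import Relation.Nullary.Decidable using (from-yes)
open import Relation.Unary using (Pred)

open +-*-Solver using (solve; _:=_; _:+_; _:*_; _:-_; :-_)

------------------------------------------------------------------------
-- Real numbers: Cauchy sequences of rationals with a modulus of
-- convergence, up to _≃_. The weak order is the negation of the strict one.

IsCauchy : (ℕ → ℚ) → Set
IsCauchy x = ∀ ε → 0ℚ ℚ.< ε → ∃[ N ] (∀ m n → N ℕ.≤ m → N ℕ.≤ n → ∣ x m ℚ.- x n ∣ ℚ.≤ ε)

record ℝ : Set where
  constructor mkℝ
  field
    seq    : ℕ → ℚ
    cauchy : IsCauchy seq

open ℝ public

infix 4 _≃_ _<ᵣ_ _≤ᵣ_

_≃_ : ℝ → ℝ → Set
x ≃ y = ∀ ε → 0ℚ ℚ.< ε → ∃[ N ] (∀ n → N ℕ.≤ n → ∣ seq x n ℚ.- seq y n ∣ ℚ.≤ ε)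

_<ᵣ_ : ℝ → ℝ → Set
x <ᵣ y = ∃[ ε ] (0ℚ ℚ.< ε × ∃[ N ] (∀ n → N ℕ.≤ n → seq x n ℚ.+ ε ℚ.≤ seq y n))

_≤ᵣ_ : ℝ → ℝ → Set
x ≤ᵣ y = ¬ (y <ᵣ x)

0<½ : 0ℚ ℚ.< ½
0<½ = from-yes (0ℚ ℚ.<? ½)

0<1 : 0ℚ ℚ.< 1ℚ
0<1 = from-yes (0ℚ ℚ.<? 1ℚ)

ℚ-*-pos : ∀ {p q} → 0ℚ ℚ.< p → 0ℚ ℚ.< q → 0ℚ ℚ.< p ℚ.* q
ℚ-*-pos {p} {q} p>0 q>0 =
  ℚ.positive⁻¹ _ {{ℚ.pos*pos⇒pos p {{ℚ.positive p>0}} q {{ℚ.positive q>0}}}}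

ℚ-*-mono : ∀ {p q r s} → 0ℚ ℚ.≤ p → 0ℚ ℚ.≤ s → p ℚ.≤ q → r ℚ.≤ s → p ℚ.* r ℚ.≤ q ℚ.* s
ℚ-*-mono {p} {q} {r} {s} p≥0 s≥0 p≤q r≤s = ℚ.≤-trans
  (ℚ.*-monoˡ-≤-nonNeg p {{ℚ.nonNegative p≥0}} r≤s)
  (ℚ.*-monoʳ-≤-nonNeg s {{ℚ.nonNegative s≥0}} p≤q)

halve : ∀ ε → 0ℚ ℚ.< ε → ∃[ η ] (0ℚ ℚ.< η × η ℚ.+ η ≡ ε)
halve ε ε>0 = ½ ℚ.* ε , ℚ-*-pos 0<½ ε>0 , trans (sym (ℚ.*-distribʳ-+ ε ½ ½)) (ℚ.*-identityˡ ε)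

recip : ∀ p → 0ℚ ℚ.< p → ℚ
recip p p>0 = (1/ p) {{ℚ.>-nonZero p>0}}

recip-pos : ∀ p (p>0 : 0ℚ ℚ.< p) → 0ℚ ℚ.< recip p p>0
recip-pos p p>0 = ℚ.positive⁻¹ _ {{ℚ.1/pos⇒pos p {{ℚ.positive p>0}}}}

recip-inverse : ∀ p (p>0 : 0ℚ ℚ.< p) → p ℚ.* recip p p>0 ≡ 1ℚ
recip-inverse p p>0 = ℚ.*-inverseʳ p {{ℚ.>-nonZero p>0}}

recip-anti : ∀ {p q} (p>0 : 0ℚ ℚ.< p) (q>0 : 0ℚ ℚ.< q) → p ℚ.≤ q → recip q q>0 ℚ.≤ recip p p>0
recip-anti {p} {q} p>0 q>0 p≤q = begin
  q⁻¹                        ≡⟨ sym (ℚ.*-identityˡ q⁻¹) ⟩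
  1ℚ ℚ.* q⁻¹                 ≡⟨ cong (ℚ._* q⁻¹) (sym (recip-inverse p p>0)) ⟩
  (p ℚ.* p⁻¹) ℚ.* q⁻¹        ≡⟨ solve 3 (λ a b c → a :* b :* c := a :* (b :* c)) refl p p⁻¹ q⁻¹ ⟩
  p ℚ.* (p⁻¹ ℚ.* q⁻¹)        ≤⟨ ℚ.*-monoʳ-≤-nonNeg _ {{ℚ.nonNegative (ℚ.<⇒≤ (ℚ-*-pos (recip-pos p p>0) (recip-pos q q>0)))}} p≤q ⟩
  q ℚ.* (p⁻¹ ℚ.* q⁻¹)        ≡⟨ solve 3 (λ a b c → a :* (b :* c) := a :* c :* b) refl q p⁻¹ q⁻¹ ⟩
  (q ℚ.* q⁻¹) ℚ.* p⁻¹        ≡⟨ cong (ℚ._* p⁻¹) (recip-inverse q q>0) ⟩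
  1ℚ ℚ.* p⁻¹                 ≡⟨ ℚ.*-identityˡ p⁻¹ ⟩
  p⁻¹                        ∎
  where
  open ℚ.≤-Reasoning
  p⁻¹ = recip p p>0
  q⁻¹ = recip q q>0

divide : ∀ p q → 0ℚ ℚ.< p → 0ℚ ℚ.< q → ∃[ r ] (0ℚ ℚ.< r × p ℚ.* r ≡ q)
divide p q p>0 q>0 = recip p p>0 ℚ.* q , ℚ-*-pos (recip-pos p p>0) q>0 ,
  trans (sym (ℚ.*-assoc p (recip p p>0) q))
    (trans (cong (ℚ._* q) (recip-inverse p p>0)) (ℚ.*-identityˡ q))

product-close : ∀ {a b c d K L δ δ′ η} → 0ℚ ℚ.≤ δ → 0ℚ ℚ.≤ δ′ → ∣ a ∣ ℚ.≤ K → ∣ d ∣ ℚ.≤ L →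
  ∣ b ℚ.- d ∣ ℚ.≤ δ → ∣ a ℚ.- c ∣ ℚ.≤ δ′ → K ℚ.* δ ≡ η → L ℚ.* δ′ ≡ η →
  ∣ a ℚ.* b ℚ.- c ℚ.* d ∣ ℚ.≤ η ℚ.+ η
product-close {a} {b} {c} {d} {K} {L} {δ} {δ′} {η} δ≥0 δ′≥0 a≤K d≤L b-d≤δ a-c≤δ′ Kδ≡η Lδ′≡η = begin
  ∣ a ℚ.* b ℚ.- c ℚ.* d ∣
    ≡⟨ cong ∣_∣ (solve 4 (λ a b c d → a :* b :- c :* d := a :* (b :- d) :+ d :* (a :- c)) refl a b c d) ⟩
  ∣ a ℚ.* (b ℚ.- d) ℚ.+ d ℚ.* (a ℚ.- c) ∣
    ≤⟨ ℚ.∣p+q∣≤∣p∣+∣q∣ (a ℚ.* (b ℚ.- d)) (d ℚ.* (a ℚ.- c)) ⟩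
  ∣ a ℚ.* (b ℚ.- d) ∣ ℚ.+ ∣ d ℚ.* (a ℚ.- c) ∣
    ≡⟨ cong₂ ℚ._+_ (ℚ.∣p*q∣≡∣p∣*∣q∣ a (b ℚ.- d)) (ℚ.∣p*q∣≡∣p∣*∣q∣ d (a ℚ.- c)) ⟩
  ∣ a ∣ ℚ.* ∣ b ℚ.- d ∣ ℚ.+ ∣ d ∣ ℚ.* ∣ a ℚ.- c ∣
    ≤⟨ ℚ.+-mono-≤
         (ℚ-*-mono {∣ a ∣} {K} {∣ b ℚ.- d ∣} {δ} (ℚ.0≤∣p∣ a) δ≥0 a≤K b-d≤δ)
         (ℚ-*-mono {∣ d ∣} {L} {∣ a ℚ.- c ∣} {δ′} (ℚ.0≤∣p∣ d) δ′≥0 d≤L a-c≤δ′) ⟩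
  K ℚ.* δ ℚ.+ L ℚ.* δ′
    ≡⟨ cong₂ ℚ._+_ Kδ≡η Lδ′≡η ⟩
  η ℚ.+ η ∎
  where open ℚ.≤-Reasoning

recip-close : ∀ {a b δ ε} (a>0 : 0ℚ ℚ.< a) (b>0 : 0ℚ ℚ.< b) → 0ℚ ℚ.< δ → 0ℚ ℚ.< ε →
  δ ℚ.≤ a → δ ℚ.≤ b → ∣ b ℚ.- a ∣ ℚ.≤ ε ℚ.* (δ ℚ.* δ) → ∣ recip a a>0 ℚ.- recip b b>0 ∣ ℚ.≤ ε
recip-close {a} {b} {δ} {ε} a>0 b>0 δ>0 ε>0 δ≤a δ≤b close = begin
  ∣ a⁻¹ ℚ.- b⁻¹ ∣
    ≡⟨ cong ∣_∣ (sym difference) ⟩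
  ∣ (a⁻¹ ℚ.* b⁻¹) ℚ.* (b ℚ.- a) ∣
    ≡⟨ ℚ.∣p*q∣≡∣p∣*∣q∣ (a⁻¹ ℚ.* b⁻¹) (b ℚ.- a) ⟩
  ∣ a⁻¹ ℚ.* b⁻¹ ∣ ℚ.* ∣ b ℚ.- a ∣
    ≡⟨ cong (ℚ._* ∣ b ℚ.- a ∣) (ℚ.0≤p⇒∣p∣≡p a⁻¹b⁻¹≥0) ⟩
  (a⁻¹ ℚ.* b⁻¹) ℚ.* ∣ b ℚ.- a ∣
    ≤⟨ ℚ-*-mono {a⁻¹ ℚ.* b⁻¹} {δ⁻¹ ℚ.* δ⁻¹} {∣ b ℚ.- a ∣} {ε ℚ.* (δ ℚ.* δ)} a⁻¹b⁻¹≥0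
         (ℚ.<⇒≤ (ℚ-*-pos {ε} {δ ℚ.* δ} ε>0 (ℚ-*-pos {δ} {δ} δ>0 δ>0)))
         (ℚ-*-mono {a⁻¹} {δ⁻¹} {b⁻¹} {δ⁻¹} (ℚ.<⇒≤ (recip-pos a a>0)) (ℚ.<⇒≤ (recip-pos δ δ>0))
           (recip-anti δ>0 a>0 δ≤a) (recip-anti δ>0 b>0 δ≤b))
         close ⟩
  (δ⁻¹ ℚ.* δ⁻¹) ℚ.* (ε ℚ.* (δ ℚ.* δ))
    ≡⟨ solve 3 (λ d r e → (r :* r) :* (e :* (d :* d)) := (d :* r) :* (d :* r) :* e) refl δ δ⁻¹ ε ⟩
  (δ ℚ.* δ⁻¹) ℚ.* (δ ℚ.* δ⁻¹) ℚ.* ε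
    ≡⟨ cong (λ u → u ℚ.* u ℚ.* ε) (recip-inverse δ δ>0) ⟩
  1ℚ ℚ.* 1ℚ ℚ.* ε
    ≡⟨ ℚ.*-identityˡ ε ⟩
  ε ∎
  where
  open ℚ.≤-Reasoning
  a⁻¹ = recip a a>0
  b⁻¹ = recip b b>0
  δ⁻¹ = recip δ δ>0
  a⁻¹b⁻¹≥0 : 0ℚ ℚ.≤ a⁻¹ ℚ.* b⁻¹
  a⁻¹b⁻¹≥0 = ℚ.<⇒≤ (ℚ-*-pos {a⁻¹} {b⁻¹} (recip-pos a a>0) (recip-pos b b>0))
  difference : (a⁻¹ ℚ.* b⁻¹) ℚ.* (b ℚ.- a) ≡ a⁻¹ ℚ.- b⁻¹
  difference = trans
    (solve 4 (λ a b r s → (r :* s) :* (b :- a) := r :* (b :* s) :- s :* (a :* r)) refl a b a⁻¹ b⁻¹)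
    (cong₂ ℚ._-_
      (trans (cong (a⁻¹ ℚ.*_) (recip-inverse b b>0)) (ℚ.*-identityʳ a⁻¹))
      (trans (cong (b⁻¹ ℚ.*_) (recip-inverse a a>0)) (ℚ.*-identityʳ b⁻¹)))

eventually-bounded : ∀ x → ∃[ K ] (0ℚ ℚ.< K × ∃[ N ] (∀ n → N ℕ.≤ n → ∣ seq x n ∣ ℚ.≤ K))
eventually-bounded x with cauchy x 1ℚ 0<1
... | N , close = ∣ seq x N ∣ ℚ.+ 1ℚ , pos , N , bound
  where
  open ℚ.≤-Reasoning
  pos : 0ℚ ℚ.< ∣ seq x N ∣ ℚ.+ 1ℚ
  pos = begin-strict
    0ℚ                     <⟨ 0<1 ⟩
    1ℚ                     ≡⟨ sym (ℚ.+-identityˡ 1ℚ) ⟩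
    0ℚ ℚ.+ 1ℚ              ≤⟨ ℚ.+-monoˡ-≤ 1ℚ (ℚ.0≤∣p∣ (seq x N)) ⟩
    ∣ seq x N ∣ ℚ.+ 1ℚ     ∎
  bound : ∀ n → N ℕ.≤ n → ∣ seq x n ∣ ℚ.≤ ∣ seq x N ∣ ℚ.+ 1ℚ
  bound n N≤n = begin
    ∣ seq x n ∣                                  ≡⟨ cong ∣_∣ (solve 2 (λ a b → b := a :+ (b :- a)) refl (seq x N) (seq x n)) ⟩
    ∣ seq x N ℚ.+ (seq x n ℚ.- seq x N) ∣        ≤⟨ ℚ.∣p+q∣≤∣p∣+∣q∣ (seq x N) _ ⟩
    ∣ seq x N ∣ ℚ.+ ∣ seq x n ℚ.- seq x N ∣      ≤⟨ ℚ.+-monoʳ-≤ ∣ seq x N ∣ (close n N N≤n ℕ.≤-refl) ⟩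
    ∣ seq x N ∣ ℚ.+ 1ℚ                           ∎

+-cauchy : ∀ x y → IsCauchy (λ n → seq x n ℚ.+ seq y n)
+-cauchy x y ε ε>0 with halve ε ε>0
... | η , η>0 , η+η≡ε with cauchy x η η>0 | cauchy y η η>0
... | M , closeˣ | N , closeʸ = M ℕ.⊔ N , λ m n ≤m ≤n → begin
    ∣ (seq x m ℚ.+ seq y m) ℚ.- (seq x n ℚ.+ seq y n) ∣
      ≡⟨ cong ∣_∣ (solve 4 (λ a b c d → (a :+ b) :- (c :+ d) := (a :- c) :+ (b :- d)) refl (seq x m) (seq y m) (seq x n) (seq y n)) ⟩
    ∣ (seq x m ℚ.- seq x n) ℚ.+ (seq y m ℚ.- seq y n) ∣
      ≤⟨ ℚ.∣p+q∣≤∣p∣+∣q∣ (seq x m ℚ.- seq x n) (seq y m ℚ.- seq y n) ⟩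
    ∣ seq x m ℚ.- seq x n ∣ ℚ.+ ∣ seq y m ℚ.- seq y n ∣
      ≤⟨ ℚ.+-mono-≤ (closeˣ m n (ℕ.m⊔n≤o⇒m≤o M N ≤m) (ℕ.m⊔n≤o⇒m≤o M N ≤n))
                    (closeʸ m n (ℕ.m⊔n≤o⇒n≤o M N ≤m) (ℕ.m⊔n≤o⇒n≤o M N ≤n)) ⟩
    η ℚ.+ η
      ≡⟨ η+η≡ε ⟩
    ε ∎
  where open ℚ.≤-Reasoning

*-cauchy : ∀ x y → IsCauchy (λ n → seq x n ℚ.* seq y n)
*-cauchy x y ε ε>0 =
  let η  , η>0  , η+η≡ε = halve ε ε>0
      K  , K>0  , M₁ , x≤K = eventually-bounded x
      L  , L>0  , M₂ , y≤L = eventually-bounded y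
      δ  , δ>0  , Kδ≡η  = divide K η K>0 η>0
      δ′ , δ′>0 , Lδ′≡η = divide L η L>0 η>0
      N₁ , closeʸ = cauchy y δ δ>0
      N₂ , closeˣ = cauchy x δ′ δ′>0
  in combine η K L δ δ′ M₁ M₂ N₁ N₂ η+η≡ε (ℚ.<⇒≤ δ>0) (ℚ.<⇒≤ δ′>0) x≤K y≤L Kδ≡η Lδ′≡η closeʸ closeˣ
  where
  combine : ∀ η K L δ δ′ M₁ M₂ N₁ N₂ → η ℚ.+ η ≡ ε → 0ℚ ℚ.≤ δ → 0ℚ ℚ.≤ δ′ →
    (∀ n → M₁ ℕ.≤ n → ∣ seq x n ∣ ℚ.≤ K) → (∀ n → M₂ ℕ.≤ n → ∣ seq y n ∣ ℚ.≤ L) →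
    K ℚ.* δ ≡ η → L ℚ.* δ′ ≡ η →
    (∀ m n → N₁ ℕ.≤ m → N₁ ℕ.≤ n → ∣ seq y m ℚ.- seq y n ∣ ℚ.≤ δ) →
    (∀ m n → N₂ ℕ.≤ m → N₂ ℕ.≤ n → ∣ seq x m ℚ.- seq x n ∣ ℚ.≤ δ′) →
    ∃[ N ] (∀ m n → N ℕ.≤ m → N ℕ.≤ n → ∣ seq x m ℚ.* seq y m ℚ.- seq x n ℚ.* seq y n ∣ ℚ.≤ ε)
  combine η K L δ δ′ M₁ M₂ N₁ N₂ refl δ≥0 δ′≥0 x≤K y≤L Kδ≡η Lδ′≡η closeʸ closeˣ =
    (M₁ ℕ.⊔ M₂) ℕ.⊔ (N₁ ℕ.⊔ N₂) , λ m n ≤m ≤n →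
    let M≤m = ℕ.m⊔n≤o⇒m≤o (M₁ ℕ.⊔ M₂) (N₁ ℕ.⊔ N₂) ≤m
        M≤n = ℕ.m⊔n≤o⇒m≤o (M₁ ℕ.⊔ M₂) (N₁ ℕ.⊔ N₂) ≤n
        N≤m = ℕ.m⊔n≤o⇒n≤o (M₁ ℕ.⊔ M₂) (N₁ ℕ.⊔ N₂) ≤m
        N≤n = ℕ.m⊔n≤o⇒n≤o (M₁ ℕ.⊔ M₂) (N₁ ℕ.⊔ N₂) ≤n
    in product-close {seq x m} {seq y m} {seq x n} {seq y n} {K} {L} {δ} {δ′} {η} δ≥0 δ′≥0
         (x≤K m (ℕ.m⊔n≤o⇒m≤o M₁ M₂ M≤m)) (y≤L n (ℕ.m⊔n≤o⇒n≤o M₁ M₂ M≤n))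
         (closeʸ m n (ℕ.m⊔n≤o⇒m≤o N₁ N₂ N≤m) (ℕ.m⊔n≤o⇒m≤o N₁ N₂ N≤n))
         (closeˣ m n (ℕ.m⊔n≤o⇒n≤o N₁ N₂ N≤m) (ℕ.m⊔n≤o⇒n≤o N₁ N₂ N≤n))
         Kδ≡η Lδ′≡η

fromℚ : ℚ → ℝ
fromℚ q = mkℝ (λ _ → q) λ ε ε>0 → 0 , λ _ _ _ _ →
  subst (ℚ._≤ ε) (sym (cong ∣_∣ (ℚ.+-inverseʳ q))) (ℚ.<⇒≤ ε>0)

0ᵣ 1ᵣ : ℝ
0ᵣ = fromℚ 0ℚ
1ᵣ = fromℚ 1ℚ

infixl 6 _+ᵣ_
infixl 7 _*ᵣ_ _÷_⟨_⟩

_+ᵣ_ : ℝ → ℝ → ℝ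
x +ᵣ y = mkℝ (λ n → seq x n ℚ.+ seq y n) (+-cauchy x y)

_*ᵣ_ : ℝ → ℝ → ℝ
x *ᵣ y = mkℝ (λ n → seq x n ℚ.* seq y n) (*-cauchy x y)

⊔-pos : ∀ q ε → 0ℚ ℚ.< ε → 0ℚ ℚ.< q ⊔ ε
⊔-pos q ε ε>0 = ℚ.<-≤-trans ε>0 (ℚ.p≤q⊔p q ε)

recip-seq : (ℕ → ℚ) → ∀ ε → 0ℚ ℚ.< ε → ℕ → ℚ
recip-seq x ε ε>0 n = recip (x n ⊔ ε) (⊔-pos (x n) ε ε>0)

recip-cauchy : ∀ x (x>0 : 0ᵣ <ᵣ x) → IsCauchy (recip-seq (seq x) (proj₁ x>0) (proj₁ (proj₂ x>0)))
recip-cauchy x (δ , δ>0 , M , x≥δ) ε ε>0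
  with cauchy x (ε ℚ.* (δ ℚ.* δ)) (ℚ-*-pos {ε} {δ ℚ.* δ} ε>0 (ℚ-*-pos {δ} {δ} δ>0 δ>0))
... | N , close = M ℕ.⊔ N , λ m n ≤m ≤n →
    recip-close (⊔-pos (seq x m) δ δ>0) (⊔-pos (seq x n) δ δ>0) δ>0 ε>0
      (ℚ.p≤q⊔p (seq x m) δ) (ℚ.p≤q⊔p (seq x n) δ)
      (subst (ℚ._≤ ε ℚ.* (δ ℚ.* δ))
        (sym (cong₂ (λ p q → ∣ p ℚ.- q ∣)
          (clamp n (ℕ.m⊔n≤o⇒m≤o M N ≤n)) (clamp m (ℕ.m⊔n≤o⇒m≤o M N ≤m))))
        (close n m (ℕ.m⊔n≤o⇒n≤o M N ≤n) (ℕ.m⊔n≤o⇒n≤o M N ≤m)))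
  where
  clamp : ∀ n → M ℕ.≤ n → seq x n ⊔ δ ≡ seq x n
  clamp n M≤n = ℚ.p≥q⇒p⊔q≡p (subst (ℚ._≤ seq x n) (ℚ.+-identityˡ δ) (x≥δ n M≤n))

-- Where x is not yet bounded away from 0 the terms are replaced by 1/ε,
-- ε being the lower bound recorded by 0 < x; this affects only finitely
-- many of them.
recipᵣ : (x : ℝ) → 0ᵣ <ᵣ x → ℝ
recipᵣ x x>0 = mkℝ (recip-seq (seq x) (proj₁ x>0) (proj₁ (proj₂ x>0))) (recip-cauchy x x>0)

_÷_⟨_⟩ : ℝ → (y : ℝ) → 0ᵣ <ᵣ y → ℝ
x ÷ y ⟨ y>0 ⟩ = x *ᵣ recipᵣ y y>0

ℝ-rawSemiring : RawSemiring 0ℓ 0ℓ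
ℝ-rawSemiring = record
  { Carrier = ℝ ; _≈_ = _≃_ ; _+_ = _+ᵣ_ ; _*_ = _*ᵣ_ ; 0# = 0ᵣ ; 1# = 1ᵣ }

-- n · x is the sum of n copies of x.
open RawSemiringOps ℝ-rawSemiring public using (_^_) renaming (_×_ to _·_)

IsLowerBound IsInfimum : Pred ℝ 0ℓ → Pred ℝ 0ℓ
IsLowerBound P x = ∀ y → P y → x ≤ᵣ y
IsInfimum    P x = IsLowerBound P x × (∀ y → IsLowerBound P y → y ≤ᵣ x)

absdiff-lower : ∀ p q ε → ∣ p ℚ.- q ∣ ℚ.≤ ε → p ℚ.- ε ℚ.≤ q
absdiff-lower p q ε close = begin
  p ℚ.- ε                 ≡⟨ solve 3 (λ p q e → p :- e := q :+ (p :- q) :- e) refl p q ε ⟩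
  q ℚ.+ (p ℚ.- q) ℚ.- ε   ≤⟨ ℚ.+-monoˡ-≤ (ℚ.- ε) (ℚ.+-monoʳ-≤ q (ℚ.≤-trans (p≤∣p∣ (p ℚ.- q)) close)) ⟩
  q ℚ.+ ε ℚ.- ε           ≡⟨ solve 2 (λ q e → q :+ e :- e := q) refl q ε ⟩
  q                       ∎
  where
  open ℚ.≤-Reasoning
  p≤∣p∣ : ∀ p → p ℚ.≤ ∣ p ∣
  p≤∣p∣ p with ℚ.≤-total 0ℚ p
  ... | inj₁ 0≤p = ℚ.≤-reflexive (sym (ℚ.0≤p⇒∣p∣≡p 0≤p))
  ... | inj₂ p≤0 = ℚ.≤-trans p≤0 (ℚ.0≤∣p∣ p)

∣p-q∣≡∣q-p∣ : ∀ p q → ∣ p ℚ.- q ∣ ≡ ∣ q ℚ.- p ∣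
∣p-q∣≡∣q-p∣ p q = trans (sym (ℚ.∣-p∣≡∣p∣ (p ℚ.- q)))
  (cong ∣_∣ (solve 2 (λ p q → :- (p :- q) := q :- p) refl p q))

⅛ : ℚ
⅛ = + 1 ℚ./ 8

0<⅛ : 0ℚ ℚ.< ⅛
0<⅛ = from-yes (0ℚ ℚ.<? ⅛)

eventually-nonNeg : ∀ x y → x ≃ 1ᵣ → x ≤ᵣ y → ∃[ N ] (∀ n → N ℕ.≤ n → 0ℚ ℚ.≤ seq y n)
eventually-nonNeg x y x≃1 x≤y with x≃1 ⅛ 0<⅛ | cauchy y ⅛ 0<⅛
... | M , x-close | N , y-close with ℚ.≤-total ½ (seq y (M ℕ.⊔ N))
... | inj₁ ½≤y = M ℕ.⊔ N , λ n ≤n → ℚ.≤-trans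
        (ℚ.≤-trans (from-yes (0ℚ ℚ.≤? ½ ℚ.- ⅛)) (ℚ.+-monoˡ-≤ (ℚ.- ⅛) ½≤y))
        (absdiff-lower (seq y (M ℕ.⊔ N)) (seq y n) ⅛ (y-close (M ℕ.⊔ N) n (ℕ.m≤n⊔m M N) (ℕ.m⊔n≤o⇒n≤o M N ≤n)))
... | inj₂ y≤½ = contradiction (⅛ , 0<⅛ , M ℕ.⊔ N , below) x≤y
  where
  open ℚ.≤-Reasoning
  below : ∀ n → M ℕ.⊔ N ℕ.≤ n → seq y n ℚ.+ ⅛ ℚ.≤ seq x n
  below n ≤n = begin
    seq y n ℚ.+ ⅛
      ≡⟨ solve 2 (λ y e → y :+ e := y :- e :+ (e :+ e)) refl (seq y n) ⅛ ⟩
    seq y n ℚ.- ⅛ ℚ.+ (⅛ ℚ.+ ⅛)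
      ≤⟨ ℚ.+-monoˡ-≤ (⅛ ℚ.+ ⅛) (ℚ.≤-trans (absdiff-lower (seq y n) (seq y (M ℕ.⊔ N)) ⅛ (y-close n (M ℕ.⊔ N) (ℕ.m⊔n≤o⇒n≤o M N ≤n) (ℕ.m≤n⊔m M N))) y≤½) ⟩
    ½ ℚ.+ (⅛ ℚ.+ ⅛)
      ≤⟨ from-yes (½ ℚ.+ (⅛ ℚ.+ ⅛) ℚ.≤? 1ℚ ℚ.- ⅛) ⟩
    1ℚ ℚ.- ⅛
      ≤⟨ absdiff-lower 1ℚ (seq x n) ⅛ (subst (ℚ._≤ ⅛) (∣p-q∣≡∣q-p∣ (seq x n) 1ℚ) (x-close n (ℕ.m⊔n≤o⇒m≤o M N ≤n))) ⟩
    seq x n ∎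

------------------------------------------------------------------------
-- Queues

-- The values α₁ ≤ … ≤ αₘ for m = 2 + k queues, indexed from zero.
record PriorityValues (k : ℕ) : Set where
  field
    value    : Fin (2 ℕ.+ k) → ℝ
    lowest   : value zero ≃ 1ᵣ
    monotone : ∀ i j → i Fin.≤ j → value i ≤ᵣ value j

  highest : ℝ
  highest = value (fromℕ (suc k))

open PriorityValues public

numerator denominator : ℝ → ℝ
numerator   a = a ^ 3 +ᵣ a ^ 2 +ᵣ a
denominator a = a ^ 4 +ᵣ 4 · a ^ 3 +ᵣ 3 · a ^ 2 +ᵣ 4 · a +ᵣ 1ᵣ

denominator>0 : ∀ {k} (α : PriorityValues k) → 0ᵣ <ᵣ denominator (highest α)
denominator>0 {k} α
  with eventually-nonNeg (value α zero) (highest α) (lowest α) (monotone α zero (fromℕ (suc k)) ℕ.z≤n)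
... | N , a≥0 = 1ℚ , 0<1 , N , λ n N≤n →
  ℚ.+-monoˡ-≤ 1ℚ {0ℚ} {seq (a ^ 4 +ᵣ 4 · a ^ 3 +ᵣ 3 · a ^ 2 +ᵣ 4 · a) n}
    (sum≥0 {seq (a ^ 4 +ᵣ 4 · a ^ 3 +ᵣ 3 · a ^ 2) n} {seq (4 · a) n}
      (sum≥0 {seq (a ^ 4 +ᵣ 4 · a ^ 3) n} {seq (3 · a ^ 2) n}
        (sum≥0 {seq (a ^ 4) n} {seq (4 · a ^ 3) n} (power≥0 4 n N≤n)
          (multiple≥0 4 (a ^ 3) n (power≥0 3 n N≤n)))
        (multiple≥0 3 (a ^ 2) n (power≥0 2 n N≤n)))
      (multiple≥0 4 a n (a≥0 n N≤n)))
  where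
  a : ℝ
  a = highest α
  sum≥0 : ∀ {p q} → 0ℚ ℚ.≤ p → 0ℚ ℚ.≤ q → 0ℚ ℚ.≤ p ℚ.+ q
  sum≥0 {p} {q} p≥0 q≥0 = ℚ.+-mono-≤ {0ℚ} {p} {0ℚ} {q} p≥0 q≥0
  power≥0 : ∀ d n → N ℕ.≤ n → 0ℚ ℚ.≤ seq (a ^ d) n
  power≥0 0       n N≤n = ℚ.<⇒≤ 0<1
  power≥0 (suc d) n N≤n =
    ℚ-*-mono {0ℚ} {seq a n} {0ℚ} {seq (a ^ d) n} ℚ.≤-refl (power≥0 d n N≤n) (a≥0 n N≤n) (power≥0 d n N≤n)
  multiple≥0 : ∀ d x n → 0ℚ ℚ.≤ seq x n → 0ℚ ℚ.≤ seq (d · x) n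
  multiple≥0 0       x n x≥0 = ℚ.≤-refl
  multiple≥0 (suc d) x n x≥0 = sum≥0 {seq x n} {seq (d · x) n} x≥0 (multiple≥0 d x n x≥0)

bound : ∀ {k} → PriorityValues k → ℝ
bound α = 1ᵣ +ᵣ numerator a ÷ denominator a ⟨ denominator>0 α ⟩
  where a = highest α

data Event (m : ℕ) : Set where
  arrival    : Fin m → Event m
  scheduling : Event m

-- The head of the list is the most recent event, so the events preceding
-- it form the tail.
Input : ℕ → Set
Input m = List (Event m)

-- All packets in a queue have the same value, so the contents of a queue
-- are determined by the number of packets in it.
Buffers : ℕ → Set
Buffers m = Vec ℕ m

-- The queue selected at a scheduling event that occurs after the given
-- events.
Selection : ℕ → Set
Selection m = Input m → Fin m

module _ {m : ℕ} (B : ℕ) where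

  accept : Fin m → Buffers m → Buffers m
  accept i b = if does (lookup b i ℕ.<? B) then b [ i ]%= suc else b

  buffersAfter : Selection m → Input m → Buffers m
  buffersAfter s []               = replicate m 0
  buffersAfter s (arrival i ∷ σ)  = accept i (buffersAfter s σ)
  buffersAfter s (scheduling ∷ σ) = buffersAfter s σ [ s σ ]%= ℕ.pred

-- The selection is unconstrained, and has no effect, when all the buffers
-- are empty.
record OnlineAlgorithm (m B : ℕ) : Set where
  field
    select         : Selection m
    workConserving : ∀ σ i → 0 ℕ.< lookup (buffersAfter B select σ) i →
                     0 ℕ.< lookup (buffersAfter B select σ) (select σ)

  buffers : Input m → Buffers m
  buffers = buffersAfter B select

open OnlineAlgorithm public

transmitted : ℕ → ℝ → ℝ
transmitted 0       v = 0ᵣ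
transmitted (suc _) v = v

gain : ∀ {k B} → PriorityValues k → OnlineAlgorithm (2 ℕ.+ k) B → Input (2 ℕ.+ k) → ℝ
gain α A []               = 0ᵣ
gain α A (arrival _ ∷ σ)  = gain α A σ
gain α A (scheduling ∷ σ) =
  gain α A σ +ᵣ transmitted (lookup (buffers A σ) (select A σ)) (value α (select A σ))

-- "Enough scheduling events for every algorithm to transmit all the
-- packets it stores."
Admissible : ∀ {m} → ℕ → Input m → Set
Admissible {m} B σ = ∀ (A : OnlineAlgorithm m B) → buffers A σ ≡ replicate m 0

-- OPT knows the whole of σ. Distinct scheduling events of σ are preceded by
-- distinct lists of events, so every way of scheduling σ, however chosen, is
-- the behaviour on σ of some OnlineAlgorithm. V_OPT(σ) is therefore the
-- maximum of the gains of these on σ, for each σ separately.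
IsOptimal : ∀ {k B} → PriorityValues k → OnlineAlgorithm (2 ℕ.+ k) B → Input (2 ℕ.+ k) → Set
IsOptimal {k} {B} α OPT σ = ∀ (A : OnlineAlgorithm (2 ℕ.+ k) B) → gain α A σ ≤ᵣ gain α OPT σ

Competitive : ∀ {k B} → PriorityValues k → OnlineAlgorithm (2 ℕ.+ k) B → Pred ℝ 0ℓ
Competitive {k} {B} α ALG c = Σ (0ᵣ <ᵣ c) λ c>0 →
  ∀ σ → Admissible B σ → (OPT : OnlineAlgorithm (2 ℕ.+ k) B) → IsOptimal α OPT σ →
  gain α OPT σ ÷ c ⟨ c>0 ⟩ ≤ᵣ gain α ALG σ

IsCompetitiveRatio : ∀ {k B} → PriorityValues k → OnlineAlgorithm (2 ℕ.+ k) B → Pred ℝ 0ℓ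
IsCompetitiveRatio α ALG = IsInfimum (Competitive α ALG)

{-# OPTIONS --safe #-}

-- Only the lowest queue 0 and the highest queue t matter. For q, r ∈ {0, t},
-- fill both queues, serve B times, refill q, serve B times, refill r, and
-- drain. An algorithm that always serves the queue about to be refilled loses
-- nothing. An online algorithm cannot anticipate q and r: it is left with
-- x(0) and x(t) packets, x(0) + x(t) = B, at the first refill, and after a
-- refill of q with y(q,0) and y(q,t) packets, where y(q,0) + y(q,t) = B -
-- x(q), at the second; on the input (q, r) it loses x(q) packets at q and
-- y(q,r) at r. Weighting the inputs (0, 0), (0, t), (t, t), (t, 0) by α³, α²,
-- 1, α makes the total loss B (α³ + α² + α) whatever the algorithm does,
-- while the total gain of the optimum is B times the sum of numerator and
-- denominator of the bound.
module Submission where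

open import Data.Bool using (if_then_else_)
open import Data.Empty using (⊥)
open import Data.Fin using (Fin; zero; suc; fromℕ)
import Data.Fin.Properties as Fin
open import Data.List using ([]; _∷_; _++_; length)
import Data.List as List
import Data.List.Properties as List
open import Data.List.Relation.Unary.All using (All; []; _∷_)
import Data.List.Relation.Unary.All.Properties as All
open import Data.Nat using (ℕ; zero; suc; _≤_; _+_)
import Data.Nat as ℕ
import Data.Nat.Properties as ℕ
open import Data.Nat.Solver using () renaming (module +-*-Solver to ℕ-Solver)
open import Data.Product using (_×_; _,_; proj₁; proj₂; ∃-syntax)
open import Data.Rational using (ℚ; 0ℚ; 1ℚ; ∣_∣)
import Data.Rational as ℚ
import Data.Rational.Properties as ℚ
open import Algebra.Properties.Monoid.Mult ℚ.+-0-monoid using (×-homo-+) renaming (_×_ to _×ℚ_)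
open import Data.Rational.Solver using (module +-*-Solver)
open +-*-Solver using (Polynomial; solve; con; _:=_; _:+_; _:*_; _:-_)
open import Data.Sum using (inj₁; inj₂)
open import Data.Vec using (Vec; []; _∷_; lookup; replicate; _[_]%=_; sum)
import Data.Vec.Properties as Vec
open import Defs
open import Function using (_∘_; const)
open import Relation.Binary.PropositionalEquality
  using (_≡_; _≢_; refl; sym; trans; cong; cong₂; subst; subst₂; module ≡-Reasoning)
open import Relation.Nullary using (¬_; Dec; contradiction; yes; no; does)
open import Relation.Nullary.Decidable using (dec-true; dec-false)

-- Rational inequalities

-- Most rational inequalities below are certified this way: the gap `d` is a nonnegative combination
-- of gaps of known inequalities, built with `_⊕_` and `_⊗_`, and the remaining equation is a ring
-- identity for the solver.
≤-from-gap : ∀ {p q d} → 0ℚ ℚ.≤ d → p ℚ.+ d ≡ q → p ℚ.≤ q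
≤-from-gap {p} {d = d} d≥0 refl = subst (ℚ._≤ p ℚ.+ d) (ℚ.+-identityʳ p) (ℚ.+-monoʳ-≤ p d≥0)

gap≥0 : ∀ {p q} → p ℚ.≤ q → 0ℚ ℚ.≤ q ℚ.- p
gap≥0 {p} {q} p≤q = subst (ℚ._≤ q ℚ.- p) (ℚ.+-inverseʳ p) (ℚ.+-monoˡ-≤ (ℚ.- p) p≤q)

infixl 6 _⊕_
infixl 7 _⊗_

_⊕_ : ∀ {p q} → 0ℚ ℚ.≤ p → 0ℚ ℚ.≤ q → 0ℚ ℚ.≤ p ℚ.+ q
_⊕_ {p} {q} p≥0 q≥0 = ℚ.+-mono-≤ {0ℚ} {p} {0ℚ} {q} p≥0 q≥0

_⊗_ : ∀ {p q} → 0ℚ ℚ.≤ p → 0ℚ ℚ.≤ q → 0ℚ ℚ.≤ p ℚ.* q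
_⊗_ {p} {q} p≥0 q≥0 = ℚ-*-mono {0ℚ} {p} {0ℚ} {q} ℚ.≤-refl q≥0 p≥0 q≥0

2ℚ 3ℚ 5ℚ 8ℚ : ℚ
2ℚ = 1ℚ ℚ.+ 1ℚ
3ℚ = 2ℚ ℚ.+ 1ℚ
5ℚ = 2ℚ ℚ.+ 2ℚ ℚ.+ 1ℚ
8ℚ = 5ℚ ℚ.+ 2ℚ ℚ.+ 1ℚ

0≤1 : 0ℚ ℚ.≤ 1ℚ
0≤1 = ℚ.<⇒≤ 0<1

-- r stands for 1/c, and u for the value of the lowest queue, which at a fixed
-- index of the Cauchy sequences is only within κ of 1.
replace-unit : ∀ P Q P′ Q′ K κ u {c r} → c ℚ.* r ≡ 1ℚ → 0ℚ ℚ.≤ c → c ℚ.≤ 2ℚ → 0ℚ ℚ.≤ κ →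
  u ℚ.- κ ℚ.≤ 1ℚ → 1ℚ ℚ.- κ ℚ.≤ u → 0ℚ ℚ.≤ P → P ℚ.≤ K → 0ℚ ℚ.≤ P′ → P′ ℚ.≤ K →
  (P ℚ.* u ℚ.+ Q) ℚ.* r ℚ.≤ P′ ℚ.* u ℚ.+ Q′ ℚ.+ K ℚ.* κ →
  P ℚ.+ Q ℚ.≤ c ℚ.* (P′ ℚ.+ Q′) ℚ.+ 5ℚ ℚ.* (K ℚ.* κ)
replace-unit P Q P′ Q′ K κ u {c} {r} cr≡1 c≥0 c≤2 κ≥0 u≲1 1≲u P≥0 P≤K P′≥0 P′≤K H =
  -- Exchanging `u` for 1 costs `K * κ` on the left and `c * (K * κ)` on the right, and the error in
  -- `H` costs another `c * (K * κ)` after multiplication by `c`. With `c ≤ 2` this makes 1 + 2 + 2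
  -- = 5.
  ≤-from-gap
    (gap≥0 H′ ⊕ P≥0 ⊗ gap≥0 1≲u ⊕ gap≥0 P≤K ⊗ κ≥0
      ⊕ c≥0 ⊗ (P′≥0 ⊗ gap≥0 u≲1 ⊕ gap≥0 P′≤K ⊗ κ≥0)
      ⊕ (0≤1 ⊕ 0≤1) ⊗ gap≥0 c≤2 ⊗ ((P≥0 ⊕ gap≥0 P≤K) ⊗ κ≥0))
    (solve 8 (λ P Q P′ Q′ K κ u c →
      P :+ Q :+
        ((c :* (P′ :* u :+ Q′ :+ K :* κ) :- (P :* u :+ Q)) :+ P :* (u :- (con 1ℚ :- κ)) :+ (K :- P) :* κ
          :+ c :* (P′ :* (con 1ℚ :- (u :- κ)) :+ (K :- P′) :* κ)
          :+ con 2ℚ :* (con 2ℚ :- c) :* ((P :+ (K :- P)) :* κ))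
      := c :* (P′ :+ Q′) :+ con 5ℚ :* (K :* κ)) refl P Q P′ Q′ K κ u c)
  where
  H′ : P ℚ.* u ℚ.+ Q ℚ.≤ c ℚ.* (P′ ℚ.* u ℚ.+ Q′ ℚ.+ K ℚ.* κ)
  H′ = subst (ℚ._≤ c ℚ.* (P′ ℚ.* u ℚ.+ Q′ ℚ.+ K ℚ.* κ))
    (trans (solve 3 (λ c x r → c :* (x :* r) := c :* r :* x) refl c (P ℚ.* u ℚ.+ Q) r)
      (trans (cong (ℚ._* (P ℚ.* u ℚ.+ Q)) cr≡1) (ℚ.*-identityˡ _)))
    (ℚ.*-monoˡ-≤-nonNeg c {{ℚ.nonNegative c≥0}} H)

num den : ℚ → ℚ
num a = a ℚ.* a ℚ.* a ℚ.+ a ℚ.* a ℚ.+ a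
den a = a ℚ.* a ℚ.* (a ℚ.* a) ℚ.+ (2ℚ ℚ.+ 2ℚ) ℚ.* (a ℚ.* a ℚ.* a)
  ℚ.+ 3ℚ ℚ.* (a ℚ.* a) ℚ.+ (2ℚ ℚ.+ 2ℚ) ℚ.* a ℚ.+ 1ℚ

:num :den : ∀ {n} → Polynomial n → Polynomial n
:num a = a :* a :* a :+ a :* a :+ a
:den a = a :* a :* (a :* a) :+ (con 2ℚ :+ con 2ℚ) :* (a :* a :* a) :+ con 3ℚ :* (a :* a) :+ (con 2ℚ :+ con 2ℚ) :* a :+ con 1ℚ

-- The four inequalities get the weights a³, a², 1, a. Then `y₀` and `yₜ` both occur with
-- coefficient a³ and merge into `xₜ`, `z₀` and `zₜ` both with coefficient a and merge into `x₀`.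
-- After that `x₀` and `xₜ` both have coefficient `num a` and merge into `β`, so the algorithm's
-- choices cancel out.
weighted-sum : ∀ {a c μ β x₀ xₜ y₀ yₜ z₀ zₜ} → β ≡ x₀ ℚ.+ xₜ → xₜ ≡ y₀ ℚ.+ yₜ → x₀ ≡ z₀ ℚ.+ zₜ → 0ℚ ℚ.≤ a →
  3ℚ ℚ.* β ℚ.+ a ℚ.* β ℚ.≤ c ℚ.* (3ℚ ℚ.* β ℚ.- x₀ ℚ.- y₀ ℚ.+ a ℚ.* β) ℚ.+ μ →
  2ℚ ℚ.* β ℚ.+ a ℚ.* (2ℚ ℚ.* β) ℚ.≤ c ℚ.* (2ℚ ℚ.* β ℚ.- x₀ ℚ.+ a ℚ.* (2ℚ ℚ.* β ℚ.- yₜ)) ℚ.+ μ →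
  β ℚ.+ a ℚ.* (3ℚ ℚ.* β) ℚ.≤ c ℚ.* (β ℚ.+ a ℚ.* (3ℚ ℚ.* β ℚ.- xₜ ℚ.- zₜ)) ℚ.+ μ →
  2ℚ ℚ.* β ℚ.+ a ℚ.* (2ℚ ℚ.* β) ℚ.≤ c ℚ.* (2ℚ ℚ.* β ℚ.- z₀ ℚ.+ a ℚ.* (2ℚ ℚ.* β ℚ.- xₜ)) ℚ.+ μ →
  β ℚ.* (den a ℚ.+ num a) ℚ.≤ c ℚ.* (β ℚ.* den a) ℚ.+ (a ℚ.* a ℚ.* a ℚ.+ a ℚ.* a ℚ.+ 1ℚ ℚ.+ a) ℚ.* μ
weighted-sum {a} {c} {μ} {y₀ = y₀} {yₜ} {z₀} {zₜ} refl refl refl a≥0 H₀₀ H₀ₜ Hₜₜ Hₜ₀ = ≤-from-gap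
  (a≥0 ⊗ a≥0 ⊗ a≥0 ⊗ gap≥0 H₀₀ ⊕ a≥0 ⊗ a≥0 ⊗ gap≥0 H₀ₜ ⊕ gap≥0 Hₜₜ ⊕ a≥0 ⊗ gap≥0 Hₜ₀)
  (solve 7 (λ a c μ y₀ yₜ z₀ zₜ →
     let x₀ = z₀ :+ zₜ ; xₜ = y₀ :+ yₜ ; β = x₀ :+ xₜ ; three = con 3ℚ ; two = con 2ℚ in
     β :* (:den a :+ :num a) :+
     (a :* a :* a :* (c :* (three :* β :- x₀ :- y₀ :+ a :* β) :+ μ :- (three :* β :+ a :* β))
     :+ a :* a :* (c :* (two :* β :- x₀ :+ a :* (two :* β :- yₜ)) :+ μ :- (two :* β :+ a :* (two :* β)))
     :+ (c :* (β :+ a :* (three :* β :- xₜ :- zₜ)) :+ μ :- (β :+ a :* (three :* β)))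
     :+ a :* (c :* (two :* β :- z₀ :+ a :* (two :* β :- xₜ)) :+ μ :- (two :* β :+ a :* (two :* β))))
     := c :* (β :* :den a) :+ (a :* a :* a :+ a :* a :+ con 1ℚ :+ a) :* μ)
    refl a c μ y₀ yₜ z₀ zₜ)

1≤den : ∀ {a} → 0ℚ ℚ.≤ a → 1ℚ ℚ.≤ den a
1≤den {a} a≥0 = ≤-from-gap
  (a≥0 ⊗ a≥0 ⊗ (a≥0 ⊗ a≥0) ⊕ 4≥0 ⊗ (a≥0 ⊗ a≥0 ⊗ a≥0) ⊕ (0≤1 ⊕ 0≤1 ⊕ 0≤1) ⊗ (a≥0 ⊗ a≥0) ⊕ 4≥0 ⊗ a≥0)
  (solve 1 (λ a → con 1ℚ :+ (a :* a :* (a :* a) :+ con (2ℚ ℚ.+ 2ℚ) :* (a :* a :* a) :+ con 3ℚ :* (a :* a) :+ con (2ℚ ℚ.+ 2ℚ) :* a) := :den a) refl a)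
  where
  4≥0 : 0ℚ ℚ.≤ 2ℚ ℚ.+ 2ℚ
  4≥0 = 0≤1 ⊕ 0≤1 ⊕ (0≤1 ⊕ 0≤1)

-- Coefficient by coefficient `num a` is at most `den a`, so the bound is at most 2. This supplies
-- the `c ≤ 2` that limits the errors in `replace-unit`; the third summand of the gap is
-- `den a - num a` times `s`.
bounded-by-2 : ∀ a c ε s → 0ℚ ℚ.≤ a → 0ℚ ℚ.≤ ε → 0ℚ ℚ.≤ s → den a ℚ.* s ≡ 1ℚ →
  c ℚ.+ ε ℚ.≤ 1ℚ ℚ.+ num a ℚ.* s → c ℚ.≤ 2ℚ
bounded-by-2 a c ε s a≥0 ε≥0 s≥0 Ds≡1 H = ≤-from-gap
  (gap≥0 H ⊕ ε≥0 ⊕ (a≥0 ⊗ a≥0 ⊗ (a≥0 ⊗ a≥0) ⊕ 3≥0 ⊗ (a≥0 ⊗ a≥0 ⊗ a≥0) ⊕ (0≤1 ⊕ 0≤1) ⊗ (a≥0 ⊗ a≥0) ⊕ 3≥0 ⊗ a≥0 ⊕ 0≤1) ⊗ s≥0)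
  (trans
    (solve 4 (λ a c ε s →
      c :+ (con 1ℚ :+ :num a :* s :- (c :+ ε) :+ ε
        :+ (a :* a :* (a :* a) :+ con 3ℚ :* (a :* a :* a) :+ con 2ℚ :* (a :* a) :+ con 3ℚ :* a :+ con 1ℚ) :* s)
      := con 1ℚ :+ :den a :* s) refl a c ε s)
    (cong (1ℚ ℚ.+_) Ds≡1))
  where
  3≥0 : 0ℚ ℚ.≤ 3ℚ
  3≥0 = 0≤1 ⊕ 0≤1 ⊕ 0≤1

-- Multiplying the slack by `β * den a` turns it into 8μ `β * den a`, while the accumulated errors
-- are 5μ times the sum of the weights. That sum is at most `den a`, and `β` and `den a` are at
-- least 1, so 8 against 5 leaves a positive surplus.
no-slack : ∀ a c s β μ → 0ℚ ℚ.≤ a → 1ℚ ℚ.≤ β → 0ℚ ℚ.< μ → den a ℚ.* s ≡ 1ℚ →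
  c ℚ.+ 8ℚ ℚ.* μ ℚ.≤ 1ℚ ℚ.+ num a ℚ.* s →
  ¬ (β ℚ.* (den a ℚ.+ num a) ℚ.≤ c ℚ.* (β ℚ.* den a) ℚ.+ (a ℚ.* a ℚ.* a ℚ.+ a ℚ.* a ℚ.+ 1ℚ ℚ.+ a) ℚ.* (5ℚ ℚ.* μ))
no-slack a c s β μ a≥0 β≥1 μ>0 Ds≡1 H K = ℚ.<-irrefl refl (ℚ.<-≤-trans μ>0 μ≤0)
  where
  D = den a
  N = num a
  μ≥0 = ℚ.<⇒≤ μ>0
  D≥0 = ℚ.≤-trans 0≤1 (1≤den a≥0)
  β≥0 = ℚ.≤-trans 0≤1 β≥1
  2≥0 : 0ℚ ℚ.≤ 2ℚ
  2≥0 = 0≤1 ⊕ 0≤1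
  H′ : D ℚ.* (c ℚ.+ 8ℚ ℚ.* μ) ℚ.≤ D ℚ.+ N
  H′ = subst (D ℚ.* (c ℚ.+ 8ℚ ℚ.* μ) ℚ.≤_)
    (trans (solve 3 (λ D N s → D :* (con 1ℚ :+ N :* s) := D :+ N :* (D :* s)) refl D N s)
      (cong (D ℚ.+_) (trans (cong (N ℚ.*_) Ds≡1) (ℚ.*-identityʳ N))))
    (ℚ.*-monoˡ-≤-nonNeg D {{ℚ.nonNegative D≥0}} H)
  3≥0 : 0ℚ ℚ.≤ 3ℚ
  3≥0 = 2≥0 ⊕ 0≤1
  5≥0 : 0ℚ ℚ.≤ 5ℚ
  5≥0 = 2≥0 ⊕ 2≥0 ⊕ 0≤1
  W≤D : a ℚ.* a ℚ.* a ℚ.+ a ℚ.* a ℚ.+ 1ℚ ℚ.+ a ℚ.≤ D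
  W≤D = ≤-from-gap
    (a≥0 ⊗ a≥0 ⊗ (a≥0 ⊗ a≥0) ⊕ 3≥0 ⊗ (a≥0 ⊗ a≥0 ⊗ a≥0) ⊕ 2≥0 ⊗ (a≥0 ⊗ a≥0) ⊕ 3≥0 ⊗ a≥0)
    (solve 1 (λ a → a :* a :* a :+ a :* a :+ con 1ℚ :+ a :+
      (a :* a :* (a :* a) :+ con 3ℚ :* (a :* a :* a) :+ con 2ℚ :* (a :* a) :+ con 3ℚ :* a)
      := :den a) refl a)
  μ≤0 : μ ℚ.≤ 0ℚ
  μ≤0 = ≤-from-gap
    (gap≥0 K ⊕ β≥0 ⊗ gap≥0 H′ ⊕ 5≥0 ⊗ μ≥0 ⊗ gap≥0 W≤D ⊕ (5≥0 ⊕ 3≥0) ⊗ μ≥0 ⊗ gap≥0 β≥1 ⊗ D≥0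
      ⊕ 3≥0 ⊗ μ≥0 ⊗ gap≥0 (1≤den a≥0) ⊕ 2≥0 ⊗ μ≥0)
    (solve 6 (λ D N W c β μ →
      μ :+ (c :* (β :* D) :+ W :* (con 5ℚ :* μ) :- β :* (D :+ N)
        :+ β :* (D :+ N :- D :* (c :+ con 8ℚ :* μ)) :+ con 5ℚ :* μ :* (D :- W)
        :+ con 8ℚ :* μ :* (β :- con 1ℚ) :* D :+ con 3ℚ :* μ :* (D :- con 1ℚ) :+ con 2ℚ :* μ)
      := con 0ℚ) refl D N (a ℚ.* a ℚ.* a ℚ.+ a ℚ.* a ℚ.+ 1ℚ ℚ.+ a) c β μ)

-- β is the buffer size; the pairs x, y and z are the occupancies of the two
-- queues at the first refill, and at the second one after the first went to the
-- lowest and to the highest queue.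
games-incompatible : ∀ {a u c r s β κ x₀ xₜ y₀ yₜ z₀ zₜ} →
  β ≡ x₀ ℚ.+ xₜ → xₜ ≡ y₀ ℚ.+ yₜ → x₀ ≡ z₀ ℚ.+ zₜ →
  0ℚ ℚ.≤ y₀ → 0ℚ ℚ.≤ yₜ → 0ℚ ℚ.≤ z₀ → 0ℚ ℚ.≤ zₜ →
  1ℚ ℚ.≤ β → 0ℚ ℚ.≤ a → 0ℚ ℚ.≤ c → c ℚ.* r ≡ 1ℚ → 0ℚ ℚ.≤ s → den a ℚ.* s ≡ 1ℚ →
  0ℚ ℚ.< κ → u ℚ.- κ ℚ.≤ 1ℚ → 1ℚ ℚ.- κ ℚ.≤ u →
  let K = 3ℚ ℚ.* β ; S = λ v w → β ℚ.* (u ℚ.+ a ℚ.+ v ℚ.+ w) in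
  c ℚ.+ 8ℚ ℚ.* (K ℚ.* κ) ℚ.≤ 1ℚ ℚ.+ num a ℚ.* s →
  S u u ℚ.* r ℚ.≤ S u u ℚ.- x₀ ℚ.* u ℚ.- y₀ ℚ.* u ℚ.+ K ℚ.* κ →
  S u a ℚ.* r ℚ.≤ S u a ℚ.- x₀ ℚ.* u ℚ.- yₜ ℚ.* a ℚ.+ K ℚ.* κ →
  S a a ℚ.* r ℚ.≤ S a a ℚ.- xₜ ℚ.* a ℚ.- zₜ ℚ.* a ℚ.+ K ℚ.* κ →
  S a u ℚ.* r ℚ.≤ S a u ℚ.- xₜ ℚ.* a ℚ.- z₀ ℚ.* u ℚ.+ K ℚ.* κ →
  ⊥
games-incompatible {a} {u} {c} {r} {s} {β} {κ} {x₀} {xₜ} {y₀} {yₜ} {z₀} {zₜ}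
  β≡ xₜ≡ x₀≡ y₀≥0 yₜ≥0 z₀≥0 zₜ≥0 β≥1 a≥0 c≥0 cr≡1 s≥0 Ds≡1 κ>0 u≲1 1≲u slack G₀₀ G₀ₜ Gₜₜ Gₜ₀ =
  no-slack a c s β (K ℚ.* κ) a≥0 β≥1 μ>0 Ds≡1 slack (weighted-sum {a} {c} {5ℚ ℚ.* (K ℚ.* κ)} β≡ xₜ≡ x₀≡ a≥0
    (clear (3ℚ ℚ.* β) (a ℚ.* β) (3ℚ ℚ.* β ℚ.- x₀ ℚ.- y₀) (a ℚ.* β)
      ℚ.≤-refl K≥0 P₀₀≥0 (≤-from-gap (x₀≥0 ⊕ y₀≥0) (solve 3 (λ K x y → K :- x :- y :+ (x :+ y) := K) refl K x₀ y₀))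
      (solve 3 (λ β u a → β :* (u :+ a :+ u :+ u) := con 3ℚ :* β :* u :+ a :* β) refl β u a)
      (solve 5 (λ β u a x y → β :* (u :+ a :+ u :+ u) :- x :* u :- y :* u := (con 3ℚ :* β :- x :- y) :* u :+ a :* β) refl β u a x₀ y₀)
      G₀₀)
    (clear (2ℚ ℚ.* β) (a ℚ.* (2ℚ ℚ.* β)) (2ℚ ℚ.* β ℚ.- x₀) (a ℚ.* (2ℚ ℚ.* β ℚ.- yₜ))
      2β≤K (2≥0 ⊗ β≥0) (2β-x≥0 x₀≤β) (ℚ.≤-trans (minus x₀≥0) 2β≤K)
      (solve 3 (λ β u a → β :* (u :+ a :+ u :+ a) := con 2ℚ :* β :* u :+ a :* (con 2ℚ :* β)) refl β u a)
      (solve 5 (λ β u a x y → β :* (u :+ a :+ u :+ a) :- x :* u :- y :* a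
        := (con 2ℚ :* β :- x) :* u :+ a :* (con 2ℚ :* β :- y)) refl β u a x₀ yₜ)
      G₀ₜ)
    (clear β (a ℚ.* (3ℚ ℚ.* β)) β (a ℚ.* (3ℚ ℚ.* β ℚ.- xₜ ℚ.- zₜ))
      β≤K β≥0 β≥0 β≤K
      (solve 3 (λ β u a → β :* (u :+ a :+ a :+ a) := β :* u :+ a :* (con 3ℚ :* β)) refl β u a)
      (solve 5 (λ β u a x y → β :* (u :+ a :+ a :+ a) :- x :* a :- y :* a
        := β :* u :+ a :* (con 3ℚ :* β :- x :- y)) refl β u a xₜ zₜ)
      Gₜₜ)
    (clear (2ℚ ℚ.* β) (a ℚ.* (2ℚ ℚ.* β)) (2ℚ ℚ.* β ℚ.- z₀) (a ℚ.* (2ℚ ℚ.* β ℚ.- xₜ))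
      2β≤K (2≥0 ⊗ β≥0) (2β-x≥0 z₀≤β) (ℚ.≤-trans (minus z₀≥0) 2β≤K)
      (solve 3 (λ β u a → β :* (u :+ a :+ a :+ u) := con 2ℚ :* β :* u :+ a :* (con 2ℚ :* β)) refl β u a)
      (solve 5 (λ β u a x y → β :* (u :+ a :+ a :+ u) :- x :* a :- y :* u
        := (con 2ℚ :* β :- y) :* u :+ a :* (con 2ℚ :* β :- x)) refl β u a xₜ z₀)
      Gₜ₀))
  where
  -- The lowest queue receives its initial filling and at most two refills, so 3β bounds the
  -- coefficient of `u` in all four games.
  K = 3ℚ ℚ.* β
  β≥0 : 0ℚ ℚ.≤ β
  β≥0 = ℚ.≤-trans 0≤1 β≥1
  2≥0 : 0ℚ ℚ.≤ 2ℚ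
  2≥0 = 0≤1 ⊕ 0≤1
  K≥0 : 0ℚ ℚ.≤ K
  K≥0 = (2≥0 ⊕ 0≤1) ⊗ β≥0
  μ>0 : 0ℚ ℚ.< K ℚ.* κ
  μ>0 = ℚ-*-pos (ℚ-*-pos (ℚ.positive⁻¹ 3ℚ) (ℚ.<-≤-trans 0<1 β≥1)) κ>0
  c≤2 : c ℚ.≤ 2ℚ
  c≤2 = bounded-by-2 a c (8ℚ ℚ.* (K ℚ.* κ)) s a≥0 ((2≥0 ⊕ 2≥0 ⊕ 0≤1 ⊕ 2≥0 ⊕ 0≤1) ⊗ (ℚ.<⇒≤ μ>0)) s≥0 Ds≡1 slack
  -- `P` and `P′` count the packets of lowest value transmitted by the optimum and by the algorithm;
  -- `Q` and `Q′` are the values of the others.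
  clear : ∀ {O G} P Q P′ Q′ → P ℚ.≤ K → 0ℚ ℚ.≤ P → 0ℚ ℚ.≤ P′ → P′ ℚ.≤ K →
    O ≡ P ℚ.* u ℚ.+ Q → G ≡ P′ ℚ.* u ℚ.+ Q′ → O ℚ.* r ℚ.≤ G ℚ.+ K ℚ.* κ →
    P ℚ.+ Q ℚ.≤ c ℚ.* (P′ ℚ.+ Q′) ℚ.+ 5ℚ ℚ.* (K ℚ.* κ)
  clear P Q P′ Q′ P≤K P≥0 P′≥0 P′≤K refl refl =
    replace-unit P Q P′ Q′ K κ u cr≡1 c≥0 c≤2 (ℚ.<⇒≤ κ>0) u≲1 1≲u P≥0 P≤K P′≥0 P′≤K
  x₀≥0 : 0ℚ ℚ.≤ x₀
  x₀≥0 = subst (0ℚ ℚ.≤_) (sym x₀≡) (z₀≥0 ⊕ zₜ≥0)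
  xₜ≥0 : 0ℚ ℚ.≤ xₜ
  xₜ≥0 = subst (0ℚ ℚ.≤_) (sym xₜ≡) (y₀≥0 ⊕ yₜ≥0)
  x₀≤β : x₀ ℚ.≤ β
  x₀≤β = ≤-from-gap xₜ≥0 (sym β≡)
  y₀≤β : y₀ ℚ.≤ β
  y₀≤β = ℚ.≤-trans (≤-from-gap yₜ≥0 (sym xₜ≡)) (≤-from-gap x₀≥0 (trans (ℚ.+-comm xₜ x₀) (sym β≡)))
  z₀≤β : z₀ ℚ.≤ β
  z₀≤β = ℚ.≤-trans (≤-from-gap zₜ≥0 (sym x₀≡)) x₀≤β
  minus : ∀ {p q} → 0ℚ ℚ.≤ q → p ℚ.- q ℚ.≤ p
  minus {p} {q} q≥0 = ≤-from-gap q≥0 (solve 2 (λ p q → p :- q :+ q := p) refl p q)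
  2β-x≥0 : ∀ {x} → x ℚ.≤ β → 0ℚ ℚ.≤ 2ℚ ℚ.* β ℚ.- x
  2β-x≥0 {x} x≤β = subst (0ℚ ℚ.≤_) (solve 2 (λ β x → β :+ (β :- x) := con 2ℚ :* β :- x) refl β x) (β≥0 ⊕ gap≥0 x≤β)
  P₀₀≥0 : 0ℚ ℚ.≤ 3ℚ ℚ.* β ℚ.- x₀ ℚ.- y₀
  P₀₀≥0 = subst (0ℚ ℚ.≤_) (solve 3 (λ β x y → β :+ (β :- x) :+ (β :- y) := con 3ℚ :* β :- x :- y) refl β x₀ y₀)
    (β≥0 ⊕ gap≥0 x₀≤β ⊕ gap≥0 y₀≤β)
  2β≤K : 2ℚ ℚ.* β ℚ.≤ K
  2β≤K = ≤-from-gap β≥0 (solve 1 (λ β → con 2ℚ :* β :+ β := con 3ℚ :* β) refl β)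
  β≤K : β ℚ.≤ K
  β≤K = ≤-from-gap (2≥0 ⊗ β≥0) (solve 1 (λ β → β :+ con 2ℚ :* β := con 3ℚ :* β) refl β)

-- Eventual inequalities between real numbers

Eventually : (ℕ → Set) → Set
Eventually P = ∃[ N ] (∀ n → N ℕ.≤ n → P n)

infixr 4 _and_

_and_ : ∀ {P Q} → Eventually P → Eventually Q → Eventually (λ n → P n × Q n)
(M , p) and (N , q) = M ℕ.⊔ N , λ n ≤n → p n (ℕ.m⊔n≤o⇒m≤o M N ≤n) , q n (ℕ.m⊔n≤o⇒n≤o M N ≤n)

map-eventually : ∀ {P Q : ℕ → Set} → (∀ n → P n → Q n) → Eventually P → Eventually Q
map-eventually f (N , p) = N , λ n N≤n → f n (p n N≤n)

add-back : ∀ p q r → p ℚ.- q ℚ.≤ r → p ℚ.≤ r ℚ.+ q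
add-back p q r H = subst (ℚ._≤ r ℚ.+ q) (solve 2 (λ p q → p :- q :+ q := p) refl p q) (ℚ.+-monoˡ-≤ q H)

-- A negated strict inequality gives no information at any single index, but rational order is
-- total. Compare at one index `L` past both moduli, after which each sequence moves by at most η.
-- If `x` exceeds `y` by 3η there, a gap of η persists forever, contradicting `x ≤ᵣ y`; otherwise
-- `x` never exceeds `y` by more than 3η + 2η.
≤ᵣ⇒eventually : ∀ {x y} → x ≤ᵣ y → ∀ ε → 0ℚ ℚ.< ε → Eventually (λ n → seq x n ℚ.≤ seq y n ℚ.+ ε)
≤ᵣ⇒eventually {x} {y} x≤y ε ε>0 with divide 5ℚ ε (ℚ.positive⁻¹ 5ℚ) ε>0
... | η , η>0 , refl with cauchy x η η>0 | cauchy y η η>0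
... | M , closeˣ | N , closeʸ = decide (ℚ.≤-total (seq x L) (seq y L ℚ.+ 3η))
  where
  open ℚ.≤-Reasoning
  L = M ℕ.⊔ N
  3η = η ℚ.+ η ℚ.+ η
  x-near : ∀ m n → L ℕ.≤ m → L ℕ.≤ n → seq x m ℚ.- η ℚ.≤ seq x n
  x-near m n ≤m ≤n = absdiff-lower (seq x m) (seq x n) η (closeˣ m n (ℕ.m⊔n≤o⇒m≤o M N ≤m) (ℕ.m⊔n≤o⇒m≤o M N ≤n))
  y-near : ∀ m n → L ℕ.≤ m → L ℕ.≤ n → seq y m ℚ.- η ℚ.≤ seq y n
  y-near m n ≤m ≤n = absdiff-lower (seq y m) (seq y n) η (closeʸ m n (ℕ.m⊔n≤o⇒n≤o M N ≤m) (ℕ.m⊔n≤o⇒n≤o M N ≤n))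
  decide : _ → Eventually (λ n → seq x n ℚ.≤ seq y n ℚ.+ 5ℚ ℚ.* η)
  decide (inj₁ x≤y+3η) = L , λ n L≤n → begin
    seq x n                                    ≤⟨ add-back (seq x n) η (seq x L) (x-near n L L≤n ℕ.≤-refl) ⟩
    seq x L ℚ.+ η                              ≤⟨ ℚ.+-monoˡ-≤ η x≤y+3η ⟩
    seq y L ℚ.+ 3η ℚ.+ η                       ≤⟨ ℚ.+-monoˡ-≤ η (ℚ.+-monoˡ-≤ 3η (add-back (seq y L) η (seq y n) (y-near L n ℕ.≤-refl L≤n))) ⟩
    seq y n ℚ.+ η ℚ.+ 3η ℚ.+ η
      ≡⟨ solve 2 (λ y e → y :+ e :+ (e :+ e :+ e) :+ e := y :+ con 5ℚ :* e) refl (seq y n) η ⟩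
    seq y n ℚ.+ 5ℚ ℚ.* η                       ∎
  decide (inj₂ y+3η≤x) = contradiction (η , η>0 , L , λ n L≤n → begin
    seq y n ℚ.+ η                              ≤⟨ ℚ.+-monoˡ-≤ η (add-back (seq y n) η (seq y L) (y-near n L L≤n ℕ.≤-refl)) ⟩
    seq y L ℚ.+ η ℚ.+ η
      ≡⟨ solve 2 (λ y e → y :+ e :+ e := y :+ (e :+ e :+ e) :- e) refl (seq y L) η ⟩
    seq y L ℚ.+ 3η ℚ.- η                       ≤⟨ ℚ.+-monoˡ-≤ (ℚ.- η) y+3η≤x ⟩
    seq x L ℚ.- η                              ≤⟨ x-near L n ℕ.≤-refl L≤n ⟩
    seq x n                                    ∎) x≤y

eventually⇒≤ᵣ : ∀ {x y} → Eventually (λ n → seq x n ℚ.≤ seq y n) → x ≤ᵣ y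
eventually⇒≤ᵣ {x} {y} (N , x≤y) (ε , ε>0 , M , y+ε≤x) = ℚ.<-irrefl refl (ℚ.<-≤-trans ε>0 (≤-from-gap
  (gap≥0 (x≤y n (ℕ.m≤m⊔n N M)) ⊕ gap≥0 (y+ε≤x n (ℕ.m≤n⊔m N M)))
  (solve 3 (λ x y ε → ε :+ (y :- x :+ (x :- (y :+ ε))) := con 0ℚ) refl (seq x n) (seq y n) ε)))
  where n = N ℕ.⊔ M

recip-clamped : ∀ {x ε} (p : 0ℚ ℚ.< x ℚ.⊔ ε) → ε ℚ.≤ x → x ℚ.* recip (x ℚ.⊔ ε) p ≡ 1ℚ
recip-clamped {x} {ε} p ε≤x = trans (cong (ℚ._* recip (x ℚ.⊔ ε) p) (sym (ℚ.p≥q⇒p⊔q≡p ε≤x)))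
  (recip-inverse (x ℚ.⊔ ε) p)

seq-numerator : ∀ x n → seq (numerator x) n ≡ num (seq x n)
seq-numerator x n = solve 1 (λ a → a :* (a :* (a :* con 1ℚ)) :+ a :* (a :* con 1ℚ) :+ a := :num a) refl (seq x n)

seq-denominator : ∀ x n → seq (denominator x) n ≡ den (seq x n)
seq-denominator x n = solve 1 (λ a →
  -- The left side copies how `_^_` and `_·_` unfold, including their final 1 and 0.
  let a² = a :* (a :* con 1ℚ) ; a³ = a :* a² in
  a :* a³ :+ (a³ :+ (a³ :+ (a³ :+ (a³ :+ con 0ℚ)))) :+ (a² :+ (a² :+ (a² :+ con 0ℚ)))
    :+ (a :+ (a :+ (a :+ (a :+ con 0ℚ)))) :+ con 1ℚ := :den a) refl (seq x n)

-- Buffers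

-- As a multiple of `1ℚ` it is additive by `×-homo-+`, and `cast (suc n)` unfolds to
-- `1ℚ ℚ.+ cast n`.
cast : ℕ → ℚ
cast n = n ×ℚ 1ℚ

cast-+ : ∀ m n → cast (m ℕ.+ n) ≡ cast m ℚ.+ cast n
cast-+ = ×-homo-+ 1ℚ

cast≥0 : ∀ n → 0ℚ ℚ.≤ cast n
cast≥0 zero    = ℚ.≤-refl
cast≥0 (suc n) = 0≤1 ⊕ cast≥0 n

cast-mono : ∀ {m n} → m ℕ.≤ n → cast m ℚ.≤ cast n
cast-mono {m} m≤n with ℕ.m≤n⇒∃[o]m+o≡n m≤n
... | o , refl = ≤-from-gap (cast≥0 o) (sym (cast-+ m o))

worth : ∀ {m} → (Fin m → ℚ) → Vec ℕ m → ℚ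
worth v []       = 0ℚ
worth v (b ∷ bs) = cast b ℚ.* v zero ℚ.+ worth (v ∘ suc) bs

worth-replicate0 : ∀ {m} (v : Fin m → ℚ) → worth v (replicate m 0) ≡ 0ℚ
worth-replicate0 {zero}  v = refl
worth-replicate0 {suc m} v = trans (cong₂ ℚ._+_ (ℚ.*-zeroˡ (v zero)) (worth-replicate0 (v ∘ suc))) (ℚ.+-identityˡ 0ℚ)

worth-update : ∀ {m} (v : Fin m → ℚ) b i f →
  worth v (b [ i ]%= f) ℚ.+ cast (lookup b i) ℚ.* v i ≡ worth v b ℚ.+ cast (f (lookup b i)) ℚ.* v i
worth-update v (b ∷ bs) zero f =
  solve 3 (λ p q r → p :+ q :+ r := r :+ q :+ p) refl (cast (f b) ℚ.* v zero) (worth (v ∘ suc) bs) (cast b ℚ.* v zero)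
worth-update v (b ∷ bs) (suc i) f = trans (ℚ.+-assoc (cast b ℚ.* v zero) _ _)
  (trans (cong (cast b ℚ.* v zero ℚ.+_) (worth-update (v ∘ suc) bs i f)) (sym (ℚ.+-assoc (cast b ℚ.* v zero) _ _)))

sum-replicate0 : ∀ m → sum (replicate m 0) ≡ 0
sum-replicate0 zero    = refl
sum-replicate0 (suc m) = sum-replicate0 m

-- The old entry is added on the left instead of being taken away on the right, which avoids
-- truncated subtraction.
sum-update : ∀ {m} (b : Vec ℕ m) i f → sum (b [ i ]%= f) ℕ.+ lookup b i ≡ sum b ℕ.+ f (lookup b i)
sum-update (b ∷ bs) zero f = ℕ-Solver.solve 3 (λ p q r → p :+ₙ q :+ₙ r :=ₙ r :+ₙ q :+ₙ p) refl (f b) (sum bs) b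
  where open ℕ-Solver renaming (_:+_ to _:+ₙ_; _:=_ to _:=ₙ_)
sum-update (b ∷ bs) (suc i) f = trans (ℕ.+-assoc b _ _)
  (trans (cong (b ℕ.+_) (sum-update bs i f)) (sym (ℕ.+-assoc b _ _)))

all-empty : ∀ {m} (b : Vec ℕ m) → (∀ i → lookup b i ≡ 0) → b ≡ replicate m 0
all-empty []       empty = refl
all-empty (b ∷ bs) empty = cong₂ _∷_ (empty zero) (all-empty bs (empty ∘ suc))

sum≡0⇒all-empty : ∀ {m} (b : Vec ℕ m) → sum b ≡ 0 → b ≡ replicate m 0
sum≡0⇒all-empty []       sum≡0 = refl
sum≡0⇒all-empty (b ∷ bs) sum≡0 =
  cong₂ _∷_ (ℕ.m+n≡0⇒m≡0 b sum≡0) (sum≡0⇒all-empty bs (ℕ.m+n≡0⇒n≡0 b sum≡0))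

sum-single : ∀ {m} (b : Vec ℕ m) j → (∀ i → i ≢ j → lookup b i ≡ 0) → sum b ≡ lookup b j
sum-single {suc m} (b ∷ bs) zero empty = trans
  (cong (b ℕ.+_) (trans (cong sum (all-empty bs (λ i → empty (suc i) λ ()))) (sum-replicate0 m))) (ℕ.+-identityʳ b)
sum-single (b ∷ bs) (suc j) empty =
  cong₂ ℕ._+_ (empty zero λ ()) (sum-single bs j (λ i i≢j → empty (suc i) (i≢j ∘ Fin.suc-injective)))

-- The latest event stands first, so the new events go in front. `B` arrivals fill the queue
-- whatever it holds, the surplus being rejected.
fill : ∀ {m} → ℕ → Fin m → Input m → Input m
fill B i σ = List.replicate B (arrival i) ++ σ

serve : ∀ {m} → ℕ → Input m → Input m
serve n σ = List.replicate n scheduling ++ σ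

accept-room : ∀ {m B} i (b : Buffers m) → lookup b i ℕ.< B → accept B i b ≡ b [ i ]%= suc
accept-room {B = B} i b l<B =
  cong (λ d → if d then b [ i ]%= suc else b) (dec-true (lookup b i ℕ.<? B) l<B)

accept-full : ∀ {m B} i (b : Buffers m) → ¬ lookup b i ℕ.< B → accept B i b ≡ b
accept-full {B = B} i b l≮B =
  cong (λ d → if d then b [ i ]%= suc else b) (dec-false (lookup b i ℕ.<? B) l≮B)

lookup-pred-empty : ∀ {m} (b : Buffers m) i j → lookup b i ≡ 0 → lookup (b [ j ]%= ℕ.pred) i ≡ 0
lookup-pred-empty b i j empty with i Fin.≟ j
... | yes refl = trans (Vec.lookup∘updateAt i b) (cong ℕ.pred empty)
... | no i≢j   = trans (Vec.lookup∘updateAt′ i j i≢j b) empty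

-- Loads along the run of an arbitrary algorithm

module Run {m B : ℕ} (A : OnlineAlgorithm m B) where

  load : Input m → Fin m → ℕ
  load σ = lookup (buffers A σ)

  load≤B : ∀ σ i → load σ i ℕ.≤ B
  load≤B []               i = subst (ℕ._≤ B) (sym (Vec.lookup-replicate i 0)) ℕ.z≤n
  load≤B (arrival j ∷ σ)  i with load σ j ℕ.<? B
  ... | no l≮B = subst (λ b → lookup b i ℕ.≤ B) (sym (accept-full j (buffers A σ) l≮B)) (load≤B σ i)
  ... | yes l<B = subst (λ b → lookup b i ℕ.≤ B) (sym (accept-room j (buffers A σ) l<B)) (room l<B (i Fin.≟ j))
    where
    room : load σ j ℕ.< B → Dec (i ≡ j) → lookup (buffers A σ [ j ]%= suc) i ℕ.≤ B
    room l<B (yes refl) = subst (ℕ._≤ B) (sym (Vec.lookup∘updateAt i (buffers A σ))) l<B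
    room l<B (no i≢j)   = subst (ℕ._≤ B) (sym (Vec.lookup∘updateAt′ i j i≢j (buffers A σ))) (load≤B σ i)
  load≤B (scheduling ∷ σ) i with i Fin.≟ select A σ
  ... | yes refl = subst (ℕ._≤ B) (sym (Vec.lookup∘updateAt i (buffers A σ))) (ℕ.≤-trans ℕ.pred[n]≤n (load≤B σ i))
  ... | no i≢j   = subst (ℕ._≤ B) (sym (Vec.lookup∘updateAt′ i _ i≢j (buffers A σ))) (load≤B σ i)

  -- Capping by `B` accounts for all rejections at once. If a further packet is accepted, the cap
  -- was not yet reached; if it is rejected, both sides equal `B`. With no arrivals the cap is
  -- harmless because of `load≤B`.
  buffers-arrivals : ∀ j i σ →
    buffers A (List.replicate j (arrival i) ++ σ) ≡ buffers A σ [ i ]%= λ l → (l ℕ.+ j) ℕ.⊓ B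
  buffers-arrivals zero i σ = sym (Vec.updateAt-id-local i (buffers A σ)
    (trans (cong (ℕ._⊓ B) (ℕ.+-identityʳ (load σ i))) (ℕ.m≤n⇒m⊓n≡m (load≤B σ i))))
  buffers-arrivals (suc j) i σ = trans (cong (accept B i) (buffers-arrivals j i σ)) (accept-one (buffers A σ))
    where
    accept-one : ∀ b → accept B i (b [ i ]%= λ l → (l ℕ.+ j) ℕ.⊓ B) ≡ b [ i ]%= λ l → (l ℕ.+ suc j) ℕ.⊓ B
    accept-one b with lookup (b [ i ]%= λ l → (l ℕ.+ j) ℕ.⊓ B) i ℕ.<? B
    ... | yes l<B = trans (accept-room i _ l<B) (Vec.updateAt-updateAt-local i b (begin
          suc ((l ℕ.+ j) ℕ.⊓ B)   ≡⟨ cong suc (ℕ.m≤n⇒m⊓n≡m (ℕ.<⇒≤ l+j<B)) ⟩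
          suc (l ℕ.+ j)           ≡⟨ ℕ.m≤n⇒m⊓n≡m l+j<B ⟨
          suc (l ℕ.+ j) ℕ.⊓ B     ≡⟨ cong (ℕ._⊓ B) (ℕ.+-suc l j) ⟨
          (l ℕ.+ suc j) ℕ.⊓ B     ∎))
      where
      open ≡-Reasoning
      l = lookup b i
      l+j<B : l ℕ.+ j ℕ.< B
      l+j<B = ℕ.≰⇒> λ B≤l+j → ℕ.<-irrefl (ℕ.m≥n⇒m⊓n≡n B≤l+j)
        (subst (ℕ._< B) (Vec.lookup∘updateAt i b) l<B)
    ... | no l≮B = trans (accept-full i _ l≮B) (Vec.updateAt-cong-local i b (trans
          (ℕ.m≥n⇒m⊓n≡n B≤l+j)
          (sym (ℕ.m≥n⇒m⊓n≡n (ℕ.≤-trans B≤l+j (ℕ.+-monoʳ-≤ (lookup b i) (ℕ.n≤1+n j)))))))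
      where
      B≤l+j : B ℕ.≤ lookup b i ℕ.+ j
      B≤l+j = ℕ.≤-trans (subst (B ℕ.≤_) (Vec.lookup∘updateAt i b) (ℕ.≮⇒≥ l≮B)) (ℕ.m⊓n≤m _ B)

  buffers-fill : ∀ i σ → buffers A (fill B i σ) ≡ buffers A σ [ i ]%= const B
  buffers-fill i σ = trans (buffers-arrivals B i σ)
    (Vec.updateAt-cong-local i (buffers A σ) (ℕ.m≥n⇒m⊓n≡n (ℕ.m≤n+m B (load σ i))))

  load-fill-other : ∀ {i j} σ → i ≢ j → load (fill B j σ) i ≡ load σ i
  load-fill-other {i} {j} σ i≢j =
    trans (cong (λ b → lookup b i) (buffers-fill j σ)) (Vec.lookup∘updateAt′ i j i≢j (buffers A σ))

  total : Input m → ℕ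
  total σ = sum (buffers A σ)

  total-fill : ∀ i σ → total (fill B i σ) ℕ.+ load σ i ≡ total σ ℕ.+ B
  total-fill i σ = trans (cong (λ b → sum b ℕ.+ load σ i) (buffers-fill i σ)) (sum-update (buffers A σ) i (const B))

  idle⇒empty : ∀ σ → load σ (select A σ) ≡ 0 → buffers A σ ≡ replicate m 0
  idle⇒empty σ idle = all-empty (buffers A σ) λ i → ℕ.n≤0⇒n≡0 (ℕ.≮⇒≥ λ l>0 →
    ℕ.<-irrefl (sym idle) (workConserving A σ i l>0))

  -- This is where work conservation enters: if the selected queue is empty then all are, and
  -- `ℕ.pred 0` is 0. Hence the total load after serving does not depend on the selections.
  total-step : ∀ σ → total (scheduling ∷ σ) ≡ ℕ.pred (total σ)
  total-step σ with load σ (select A σ) in eq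
  ... | zero = begin
      total (scheduling ∷ σ)
        ≡⟨ cong sum (Vec.updateAt-id-local (select A σ) (buffers A σ) (trans (cong ℕ.pred eq) (sym eq))) ⟩
      total σ                  ≡⟨ total≡0 ⟩
      0                        ≡⟨ cong ℕ.pred total≡0 ⟨
      ℕ.pred (total σ)         ∎
    where
    open ≡-Reasoning
    total≡0 : total σ ≡ 0
    total≡0 = trans (cong sum (idle⇒empty σ eq)) (sum-replicate0 m)
  ... | suc l = cong ℕ.pred {x = suc (total (scheduling ∷ σ))} (ℕ.+-cancelʳ-≡ l _ _ (begin
      suc (total (scheduling ∷ σ)) ℕ.+ l               ≡⟨ ℕ.+-suc (total (scheduling ∷ σ)) l ⟨
      total (scheduling ∷ σ) ℕ.+ suc l                 ≡⟨ cong (total (scheduling ∷ σ) ℕ.+_) eq ⟨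
      total (scheduling ∷ σ) ℕ.+ load σ (select A σ)   ≡⟨ sum-update (buffers A σ) (select A σ) ℕ.pred ⟩
      total σ ℕ.+ ℕ.pred (load σ (select A σ))         ≡⟨ cong (λ x → total σ ℕ.+ ℕ.pred x) eq ⟩
      total σ ℕ.+ l                                    ∎))
    where open ≡-Reasoning

  total-serve : ∀ n σ → total (serve n σ) ≡ total σ ℕ.∸ n
  total-serve zero    σ = refl
  total-serve (suc n) σ = trans (total-step (serve n σ))
    (trans (cong ℕ.pred (total-serve n σ)) (ℕ.pred[m∸n]≡m∸[1+n] (total σ) n))

  total-event : ∀ e σ → total (e ∷ σ) ℕ.≤ suc (total σ)
  total-event scheduling  σ = ℕ.≤-trans (ℕ.≤-reflexive (total-step σ)) (ℕ.≤-trans ℕ.pred[n]≤n (ℕ.n≤1+n _))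
  total-event (arrival i) σ with load σ i ℕ.<? B
  ... | no l≮B  = ℕ.≤-trans (ℕ.≤-reflexive (cong sum (accept-full i (buffers A σ) l≮B))) (ℕ.n≤1+n _)
  ... | yes l<B = ℕ.≤-reflexive (trans (cong sum (accept-room i (buffers A σ) l<B)) (ℕ.+-cancelʳ-≡ (load σ i) _ _
    (trans (sum-update (buffers A σ) i suc) (ℕ.+-suc (total σ) (load σ i)))))

  total≤length : ∀ σ → total σ ℕ.≤ length σ
  total≤length []      = ℕ.≤-reflexive (sum-replicate0 m)
  total≤length (e ∷ σ) = ℕ.≤-trans (total-event e σ) (ℕ.s≤s (total≤length σ))

  -- Each event adds at most one packet, so `length σ` scheduling events suffice for every algorithm
  -- at once. This crude count makes the adversary's inputs admissible.
  drained : ∀ σ → buffers A (serve (length σ) σ) ≡ replicate m 0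
  drained σ = sum≡0⇒all-empty _ (trans (total-serve (length σ) σ) (ℕ.m≤n⇒m∸n≡0 (total≤length σ)))

  no-arrivals⇒empty : ∀ {i} σ → All (_≢ arrival i) σ → load σ i ≡ 0
  no-arrivals⇒empty {i} [] [] = Vec.lookup-replicate i 0
  no-arrivals⇒empty {i} (arrival j ∷ σ) (j≢i ∷ none) with load σ j ℕ.<? B
  ... | no l≮B  = trans (cong (λ b → lookup b i) (accept-full j (buffers A σ) l≮B)) (no-arrivals⇒empty σ none)
  ... | yes l<B = trans (cong (λ b → lookup b i) (accept-room j (buffers A σ) l<B)) (trans
      (Vec.lookup∘updateAt′ i j (λ i≡j → j≢i (cong arrival (sym i≡j))) (buffers A σ)) (no-arrivals⇒empty σ none))
  no-arrivals⇒empty {i} (scheduling ∷ σ) (_ ∷ none) =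
    lookup-pred-empty (buffers A σ) i (select A σ) (no-arrivals⇒empty σ none)

-- Gains

module Account {k B : ℕ} (α : PriorityValues k) (A : OnlineAlgorithm (2 ℕ.+ k) B) (n : ℕ) where

  open Run A

  v : Fin (2 ℕ.+ k) → ℚ
  v i = seq (value α i) n

  -- Gain so far plus the value still stored, at index `n` of the Cauchy sequences. Scheduling
  -- leaves it unchanged and arrivals change it by the value of accepted packets, so the final gain
  -- is found without following the order of transmission.
  account : Input (2 ℕ.+ k) → ℚ
  account σ = seq (gain α A σ) n ℚ.+ worth v (buffers A σ)

  transmitted-conserves : ∀ b i →
    seq (transmitted (lookup b i) (value α i)) n ℚ.+ worth v (b [ i ]%= ℕ.pred) ≡ worth v b
  transmitted-conserves b i with lookup b i in eq
  ... | zero  = trans (ℚ.+-identityˡ _) (cong (worth v) (Vec.updateAt-id-local i b (trans (cong ℕ.pred eq) (sym eq))))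
  ... | suc l = begin
      v i ℚ.+ worth v b′
        ≡⟨ solve 3 (λ x w l → x :+ w := w :+ (con 1ℚ :+ l) :* x :- l :* x) refl (v i) (worth v b′) (cast l) ⟩
      worth v b′ ℚ.+ cast (suc l) ℚ.* v i ℚ.- cast l ℚ.* v i
        ≡⟨ cong (λ z → worth v b′ ℚ.+ cast z ℚ.* v i ℚ.- cast l ℚ.* v i) eq ⟨
      worth v b′ ℚ.+ cast (lookup b i) ℚ.* v i ℚ.- cast l ℚ.* v i     ≡⟨ cong (ℚ._- cast l ℚ.* v i) (worth-update v b i ℕ.pred) ⟩
      worth v b ℚ.+ cast (ℕ.pred (lookup b i)) ℚ.* v i ℚ.- cast l ℚ.* v i
        ≡⟨ cong (λ z → worth v b ℚ.+ cast (ℕ.pred z) ℚ.* v i ℚ.- cast l ℚ.* v i) eq ⟩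
      worth v b ℚ.+ cast l ℚ.* v i ℚ.- cast l ℚ.* v i
        ≡⟨ solve 2 (λ w y → w :+ y :- y := w) refl (worth v b) (cast l ℚ.* v i) ⟩
      worth v b                                                       ∎
    where
    open ≡-Reasoning
    b′ = b [ i ]%= ℕ.pred

  account-serve : ∀ j σ → account (serve j σ) ≡ account σ
  account-serve zero    σ = refl
  account-serve (suc j) σ = trans (ℚ.+-assoc (seq (gain α A (serve j σ)) n) _ _)
    (trans (cong (seq (gain α A (serve j σ)) n ℚ.+_) (transmitted-conserves (buffers A (serve j σ)) (select A (serve j σ))))
      (account-serve j σ))

  gain-arrivals : ∀ j i σ → gain α A (List.replicate j (arrival i) ++ σ) ≡ gain α A σ
  gain-arrivals zero    i σ = refl
  gain-arrivals (suc j) i σ = gain-arrivals j i σ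

  account-fill : ∀ i σ → account (fill B i σ) ≡ account σ ℚ.+ cast B ℚ.* v i ℚ.- cast (load σ i) ℚ.* v i
  account-fill i σ = begin
    seq (gain α A (fill B i σ)) n ℚ.+ worth v (buffers A (fill B i σ))
      ≡⟨ cong₂ (λ g b → seq g n ℚ.+ worth v b) (gain-arrivals B i σ) (buffers-fill i σ) ⟩
    g ℚ.+ worth v b′
      ≡⟨ solve 3 (λ g w l → g :+ w := g :+ (w :+ l) :- l) refl g (worth v b′) (cast (load σ i) ℚ.* v i) ⟩
    g ℚ.+ (worth v b′ ℚ.+ cast (load σ i) ℚ.* v i) ℚ.- cast (load σ i) ℚ.* v i
      ≡⟨ cong (λ x → g ℚ.+ x ℚ.- cast (load σ i) ℚ.* v i) (worth-update v (buffers A σ) i (const B)) ⟩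
    g ℚ.+ (worth v (buffers A σ) ℚ.+ cast B ℚ.* v i) ℚ.- cast (load σ i) ℚ.* v i
      ≡⟨ cong (ℚ._- cast (load σ i) ℚ.* v i) (ℚ.+-assoc g _ _) ⟨
    account σ ℚ.+ cast B ℚ.* v i ℚ.- cast (load σ i) ℚ.* v i ∎
    where
    open ≡-Reasoning
    g  = seq (gain α A σ) n
    b′ = buffers A σ [ i ]%= const B

  account-[] : account [] ≡ 0ℚ
  account-[] = trans (ℚ.+-identityˡ _) (worth-replicate0 v)

  account-flush : ∀ σ → seq (gain α A (serve (length σ) σ)) n ≡ account σ
  account-flush σ = begin
    seq (gain α A (serve (length σ) σ)) n   ≡⟨ ℚ.+-identityʳ _ ⟨
    seq (gain α A (serve (length σ) σ)) n ℚ.+ 0ℚ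
      ≡⟨ cong (seq (gain α A (serve (length σ) σ)) n ℚ.+_) (trans (cong (worth v) (drained σ)) (worth-replicate0 v)) ⟨
    account (serve (length σ) σ)   ≡⟨ account-serve (length σ) σ ⟩
    account σ ∎
    where open ≡-Reasoning

-- Work-conserving algorithms from preferences

pick : ∀ {m} → Fin m → Buffers m → Fin m
pick p b with 0 ℕ.<? lookup b p
... | yes _ = p
... | no  _ with Fin.any? (λ i → 0 ℕ.<? lookup b i)
...   | yes (i , _) = i
-- All buffers are empty here, so the selection has no effect.
...   | no  _       = p

pick-nonEmpty : ∀ {m} (p : Fin m) b i → 0 ℕ.< lookup b i → 0 ℕ.< lookup b (pick p b)
pick-nonEmpty p b i bᵢ>0 with 0 ℕ.<? lookup b p
... | yes bₚ>0 = bₚ>0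
... | no  _ with Fin.any? (λ i → 0 ℕ.<? lookup b i)
...   | yes (_ , b>0) = b>0
...   | no none       = contradiction (i , bᵢ>0) none

module Preferring {m : ℕ} (B : ℕ) (prefer : Input m → Fin m) where

  -- The selection looks at the buffers, which `buffersAfter` computes from the selection. Running
  -- both in one recursion over the input breaks this circle; `buffersAfter-choose` shows that the
  -- result is the actual run.
  contents : Input m → Buffers m
  contents []               = replicate m 0
  contents (arrival i ∷ σ)  = accept B i (contents σ)
  contents (scheduling ∷ σ) = contents σ [ pick (prefer σ) (contents σ) ]%= ℕ.pred

  choose : Selection m
  choose σ = pick (prefer σ) (contents σ)

  buffersAfter-choose : ∀ σ → buffersAfter B choose σ ≡ contents σ
  buffersAfter-choose []               = refl
  buffersAfter-choose (arrival i ∷ σ)  = cong (accept B i) (buffersAfter-choose σ)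
  buffersAfter-choose (scheduling ∷ σ) = cong (_[ choose σ ]%= ℕ.pred) (buffersAfter-choose σ)

  algorithm : OnlineAlgorithm m B
  algorithm = record
    { select         = choose
    ; workConserving = λ σ i → subst (λ b → 0 ℕ.< lookup b i → 0 ℕ.< lookup b (choose σ))
        (sym (buffersAfter-choose σ)) (pick-nonEmpty (prefer σ) (contents σ) i)
    }

  open Run algorithm

  -- If the preferred queue is empty, another one may be served, but then its load stays 0, which is
  -- `ℕ.pred 0`. So no case distinction is left for repeated service.
  load-step-preferred : ∀ {q} σ → prefer σ ≡ q → load (scheduling ∷ σ) q ≡ ℕ.pred (load σ q)
  load-step-preferred σ refl rewrite buffersAfter-choose σ with 0 ℕ.<? lookup (contents σ) (prefer σ)
  ... | yes _  = Vec.lookup∘updateAt (prefer σ) (contents σ)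
  ... | no b≯0 = trans (lookup-pred-empty (contents σ) (prefer σ) _ b≡0) (cong ℕ.pred (sym b≡0))
    where
    b≡0 : lookup (contents σ) (prefer σ) ≡ 0
    b≡0 = ℕ.n≤0⇒n≡0 (ℕ.≮⇒≥ b≯0)

  load-serve-preferred : ∀ j q σ → (∀ i → i ℕ.< j → prefer (serve i σ) ≡ q) → load (serve j σ) q ≡ load σ q ℕ.∸ j
  load-serve-preferred zero    q σ pref = refl
  load-serve-preferred (suc j) q σ pref = begin
    load (scheduling ∷ serve j σ) q   ≡⟨ load-step-preferred (serve j σ) (pref j ℕ.≤-refl) ⟩
    ℕ.pred (load (serve j σ) q)
      ≡⟨ cong ℕ.pred (load-serve-preferred j q σ (λ i i<j → pref i (ℕ.m<n⇒m<1+n i<j))) ⟩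
    ℕ.pred (load σ q ℕ.∸ j)           ≡⟨ ℕ.pred[m∸n]≡m∸[1+n] (load σ q) j ⟩
    load σ q ℕ.∸ suc j                ∎
    where open ≡-Reasoning

-- The adversary

module Adversary (B k : ℕ) where

  m : ℕ
  m = 2 ℕ.+ k

  top : Fin m
  top = fromℕ (suc k)

  full opening : Input m
  full    = fill B top (fill B zero [])
  opening = serve B full

  middle : Fin m → Input m
  middle q = serve B (fill B q opening)

  input : Fin m → Fin m → Input m
  input q r = serve (length (fill B r (middle q))) (fill B r (middle q))

  input-admissible : ∀ q r → Admissible B (input q r)
  input-admissible q r A = Run.drained A (fill B r (middle q))

  module _ (A : OnlineAlgorithm m B) where

    open Run A

    -- The two opening fills meet empty queues and lose nothing. Each refill rejects as many packets
    -- as its queue still holds, and the final drain transmits all that is stored.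
    gain-input : ∀ α n q r → let v i = seq (value α i) n in
      seq (gain α A (input q r)) n ≡
      cast B ℚ.* (v zero ℚ.+ v top ℚ.+ v q ℚ.+ v r) ℚ.- cast (load opening q) ℚ.* v q ℚ.- cast (load (middle q) r) ℚ.* v r
    gain-input α n q r = begin
      seq (gain α A (input q r)) n        ≡⟨ account-flush (fill B r (middle q)) ⟩
      account (fill B r (middle q))       ≡⟨ filled r (account-serve B (fill B q opening)) ⟩
      account (fill B q opening) ℚ.+ β ℚ.* v r ℚ.- Y
        ≡⟨ cong (λ x → x ℚ.+ β ℚ.* v r ℚ.- Y) (filled q (account-serve B full)) ⟩
      account full ℚ.+ β ℚ.* v q ℚ.- X ℚ.+ β ℚ.* v r ℚ.- Y
        ≡⟨ cong (λ x → x ℚ.+ β ℚ.* v q ℚ.- X ℚ.+ β ℚ.* v r ℚ.- Y) account-full ⟩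
      β ℚ.* v zero ℚ.+ β ℚ.* v top ℚ.+ β ℚ.* v q ℚ.- X ℚ.+ β ℚ.* v r ℚ.- Y
        ≡⟨ solve 7 (λ β v₀ vₜ vq vr X Y → β :* v₀ :+ β :* vₜ :+ β :* vq :- X :+ β :* vr :- Y
             := β :* (v₀ :+ vₜ :+ vq :+ vr) :- X :- Y) refl β (v zero) (v top) (v q) (v r) X Y ⟩
      β ℚ.* (v zero ℚ.+ v top ℚ.+ v q ℚ.+ v r) ℚ.- X ℚ.- Y ∎
      where
      open ≡-Reasoning
      open Account α A n
      β = cast B
      X = cast (load opening q) ℚ.* v q
      Y = cast (load (middle q) r) ℚ.* v r
      filled : ∀ {σ x} i → account σ ≡ x → account (fill B i σ) ≡ x ℚ.+ β ℚ.* v i ℚ.- cast (load σ i) ℚ.* v i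
      filled {σ} i refl = account-fill i σ
      filled-empty : ∀ {σ x} i → load σ i ≡ 0 → account σ ≡ x → account (fill B i σ) ≡ x ℚ.+ β ℚ.* v i
      filled-empty {σ} {x} i empty eq = trans (filled i eq)
        (trans (cong (λ l → x ℚ.+ β ℚ.* v i ℚ.- cast l ℚ.* v i) empty)
          (solve 3 (λ x y w → x :+ y :- con 0ℚ :* w := x :+ y) refl x (β ℚ.* v i) (v i)))
      account-full : account full ≡ β ℚ.* v zero ℚ.+ β ℚ.* v top
      account-full = filled-empty top
        (trans (load-fill-other [] λ ()) (no-arrivals⇒empty {top} [] []))
        (trans (filled-empty zero (no-arrivals⇒empty {zero} [] []) account-[]) (ℚ.+-identityˡ (β ℚ.* v zero)))

    total-opening : total opening ≡ B
    total-opening = begin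
      total opening                   ≡⟨ total-serve B full ⟩
      total full ℕ.∸ B
        ≡⟨ cong (ℕ._∸ B) (total-fill-empty top (fill B zero []) (trans (load-fill-other [] λ ()) (no-arrivals⇒empty {top} [] []))) ⟩
      total (fill B zero []) ℕ.+ B ℕ.∸ B   ≡⟨ ℕ.m+n∸n≡m (total (fill B zero [])) B ⟩
      total (fill B zero [])          ≡⟨ total-fill-empty zero [] (no-arrivals⇒empty {zero} [] []) ⟩
      total [] ℕ.+ B                  ≡⟨ cong (ℕ._+ B) (sum-replicate0 m) ⟩
      B                               ∎
      where
      open ≡-Reasoning
      total-fill-empty : ∀ i σ → load σ i ≡ 0 → total (fill B i σ) ≡ total σ ℕ.+ B
      total-fill-empty i σ empty = trans (sym (ℕ.+-identityʳ _))
        (trans (cong (total (fill B i σ) ℕ.+_) (sym empty)) (total-fill i σ))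

    -- The refill raises the total from `B` to 2B minus the load found at `q`, and serving removes
    -- `B`. As that load is at most `B`, the total before serving is at least `B` and the truncated
    -- subtraction is exact.
    total-middle : ∀ q → total (middle q) ℕ.+ load opening q ≡ B
    total-middle q = begin
      total (middle q) ℕ.+ x                 ≡⟨ cong (ℕ._+ x) (total-serve B (fill B q opening)) ⟩
      total (fill B q opening) ℕ.∸ B ℕ.+ x   ≡⟨ ℕ.+-∸-comm x B≤total ⟨
      total (fill B q opening) ℕ.+ x ℕ.∸ B   ≡⟨ cong (ℕ._∸ B) filled ⟩
      B ℕ.+ B ℕ.∸ B                          ≡⟨ ℕ.m+n∸n≡m B B ⟩
      B                                      ∎
      where
      open ≡-Reasoning
      x = load opening q
      filled : total (fill B q opening) ℕ.+ x ≡ B ℕ.+ B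
      filled = trans (total-fill q opening) (cong (ℕ._+ B) total-opening)
      B≤total : B ℕ.≤ total (fill B q opening)
      B≤total = ℕ.+-cancelʳ-≤ x B _ (ℕ.≤-trans (ℕ.+-monoʳ-≤ B (load≤B opening q)) (ℕ.≤-reflexive (sym filled)))

    total-two-queues : ∀ σ → (∀ i → i ≢ zero → i ≢ top → All (_≢ arrival i) σ) →
      total σ ≡ load σ zero ℕ.+ load σ top
    total-two-queues σ none with buffers A σ in eq
    -- `top` is `suc (fromℕ k)`, so in the tail it has index `fromℕ k`, and every other entry of the
    -- tail is 0.
    ... | b ∷ bs = cong (b ℕ.+_) (sum-single bs (fromℕ k) λ i i≢t →
      trans (cong (λ z → lookup z (suc i)) (sym eq)) (no-arrivals⇒empty σ (none (suc i) (λ ()) (i≢t ∘ Fin.suc-injective))))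

    opening-arrivals : ∀ i → i ≢ zero → i ≢ top → All (_≢ arrival i) opening
    opening-arrivals i i≢0 i≢t = All.++⁺ (All.replicate⁺ B λ ())
      (All.++⁺ (All.replicate⁺ B λ { refl → i≢t refl }) (All.++⁺ (All.replicate⁺ B λ { refl → i≢0 refl }) []))

    middle-arrivals : ∀ {q} i → i ≢ q → i ≢ zero → i ≢ top → All (_≢ arrival i) (middle q)
    middle-arrivals i i≢q i≢0 i≢t = All.++⁺ (All.replicate⁺ B λ ())
      (All.++⁺ (All.replicate⁺ B λ { refl → i≢q refl }) (opening-arrivals i i≢0 i≢t))

    load-opening : load opening zero ℕ.+ load opening top ≡ B
    load-opening = trans (sym (total-two-queues opening opening-arrivals)) total-opening

    -- What remains is `B` minus the load found at the refilled queue, and by `load-opening` this is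
    -- the load that the other queue had. These links between the two stages are what `weighted-sum`
    -- exploits.
    load-middle-zero : load (middle zero) zero ℕ.+ load (middle zero) top ≡ load opening top
    load-middle-zero = ℕ.+-cancelʳ-≡ (load opening zero) _ _ (begin
      load (middle zero) zero ℕ.+ load (middle zero) top ℕ.+ load opening zero
        ≡⟨ cong (ℕ._+ load opening zero) (total-two-queues (middle zero) λ i i≢0 → middle-arrivals i i≢0 i≢0) ⟨
      total (middle zero) ℕ.+ load opening zero       ≡⟨ total-middle zero ⟩
      B                                               ≡⟨ load-opening ⟨
      load opening zero ℕ.+ load opening top          ≡⟨ ℕ.+-comm (load opening zero) _ ⟩
      load opening top ℕ.+ load opening zero          ∎)
      where open ≡-Reasoning

    load-middle-top : load (middle top) zero ℕ.+ load (middle top) top ≡ load opening zero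
    load-middle-top = ℕ.+-cancelʳ-≡ (load opening top) _ _ (begin
      load (middle top) zero ℕ.+ load (middle top) top ℕ.+ load opening top
        ≡⟨ cong (ℕ._+ load opening top) (total-two-queues (middle top) λ i i≢0 i≢t → middle-arrivals i i≢t i≢0 i≢t) ⟨
      total (middle top) ℕ.+ load opening top         ≡⟨ total-middle top ⟩
      B                                               ≡⟨ load-opening ⟨
      load opening zero ℕ.+ load opening top          ∎)
      where open ≡-Reasoning

  -- The length of the past serves as a clock: it is below `length opening` throughout the first
  -- round of service and never afterwards, so `q` is preferred before the first refill and `r` from
  -- then on.
  prefer : Fin m → Fin m → Input m → Fin m
  prefer q r σ = if does (length σ ℕ.<? length opening) then q else r

  optimal : Fin m → Fin m → OnlineAlgorithm m B
  optimal q r = Preferring.algorithm B (prefer q r)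

  module _ (q r : Fin m) where

    open Run (optimal q r)

    length-serve : ∀ j (σ : Input m) → length (serve j σ) ≡ j ℕ.+ length σ
    length-serve j σ = trans (List.length-++ (List.replicate j scheduling)) (cong (ℕ._+ length σ) (List.length-replicate j))

    -- A queue holding at most `B` packets and preferred in `B` consecutive scheduling events is
    -- empty when its refill comes.
    optimal-opening : load opening q ≡ 0
    optimal-opening = trans
      (Preferring.load-serve-preferred B (prefer q r) B q full λ i i<B →
        cong (if_then q else r) (dec-true (length (serve i full) ℕ.<? length opening)
          (subst₂ ℕ._<_ (sym (length-serve i full)) (sym (length-serve B full)) (ℕ.+-monoˡ-< (length full) i<B))))
      (ℕ.m≤n⇒m∸n≡0 (load≤B full q))

    optimal-middle : load (middle q) r ≡ 0
    optimal-middle = trans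
      (Preferring.load-serve-preferred B (prefer q r) B r (fill B q opening) λ i _ →
        cong (if_then q else r) (dec-false (length (serve i (fill B q opening)) ℕ.<? length opening)
          (ℕ.≤⇒≯ (subst (length opening ℕ.≤_) (sym (trans (length-serve i (fill B q opening)) (cong (i ℕ.+_) (List.length-++ (List.replicate B (arrival q))))))
            (ℕ.≤-trans (ℕ.m≤n+m _ _) (ℕ.m≤n+m _ i))))))
      (ℕ.m≤n⇒m∸n≡0 (load≤B (fill B q opening) r))

  gain-optimal : ∀ α n q r → let v i = seq (value α i) n in
    seq (gain α (optimal q r) (input q r)) n ≡ cast B ℚ.* (v zero ℚ.+ v top ℚ.+ v q ℚ.+ v r)
  gain-optimal α n q r = begin
    seq (gain α (optimal q r) (input q r)) n   ≡⟨ gain-input (optimal q r) α n q r ⟩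
    S ℚ.- cast (load opening q) ℚ.* v q ℚ.- cast (load (middle q) r) ℚ.* v r
      ≡⟨ cong₂ (λ x y → S ℚ.- cast x ℚ.* v q ℚ.- cast y ℚ.* v r) (optimal-opening q r) (optimal-middle q r) ⟩
    S ℚ.- 0ℚ ℚ.* v q ℚ.- 0ℚ ℚ.* v r
      ≡⟨ solve 3 (λ s x y → s :- con 0ℚ :* x :- con 0ℚ :* y := s) refl S (v q) (v r) ⟩
    S ∎
    where
    open ≡-Reasoning
    open Run (optimal q r)
    v : Fin m → ℚ
    v i = seq (value α i) n
    S = cast B ℚ.* (v zero ℚ.+ v top ℚ.+ v q ℚ.+ v r)

  -- By `gain-input` all algorithms gain the same sum less two losses, which are eventually
  -- nonnegative because the values are; `optimal q r` has no losses.
  optimal-isOptimal : ∀ α q r → IsOptimal α (optimal q r) (input q r)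
  optimal-isOptimal α q r A with value≥0 q | value≥0 r
    where
    value≥0 : ∀ i → Eventually (λ n → 0ℚ ℚ.≤ seq (value α i) n)
    value≥0 i = eventually-nonNeg (value α zero) (value α i) (lowest α) (monotone α zero i ℕ.z≤n)
  ... | N , vq≥0 | N′ , vr≥0 =
    eventually⇒≤ᵣ {gain α A (input q r)} {gain α (optimal q r) (input q r)} (N ℕ.⊔ N′ , λ n N⊔N′≤n → let v i = seq (value α i) n in
      ≤-from-gap
        (cast≥0 (load opening q) ⊗ vq≥0 n (ℕ.m⊔n≤o⇒m≤o N N′ N⊔N′≤n)
          ⊕ cast≥0 (load (middle q) r) ⊗ vr≥0 n (ℕ.m⊔n≤o⇒n≤o N N′ N⊔N′≤n))
        (trans (cong (ℚ._+ (cast (load opening q) ℚ.* v q ℚ.+ cast (load (middle q) r) ℚ.* v r)) (gain-input A α n q r))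
          (trans (solve 3 (λ s x y → s :- x :- y :+ (x :+ y) := s) refl
              (cast B ℚ.* (v zero ℚ.+ v top ℚ.+ v q ℚ.+ v r)) (cast (load opening q) ℚ.* v q) (cast (load (middle q) r) ℚ.* v r))
            (sym (gain-optimal α n q r)))))
    where open Run A

-- Refutation of a competitive factor below the bound

module LowerBound {B k : ℕ} (1≤B : 1 ℕ.≤ B) (α : PriorityValues k) (ALG : OnlineAlgorithm (2 ℕ.+ k) B)
  (c : ℝ) (c>0 : 0ᵣ <ᵣ c)
  (competitive : ∀ σ → Admissible B σ → (OPT : OnlineAlgorithm (2 ℕ.+ k) B) → IsOptimal α OPT σ →
    gain α OPT σ ÷ c ⟨ c>0 ⟩ ≤ᵣ gain α ALG σ)
  -- `κ` is the tolerance for the lowest value being 1, and `μ` the one for passing from `≤ᵣ` to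
  -- rationals; the equation lets both appear as the single error `K * κ` of `games-incompatible`.
  (μ κ : ℚ) (μ>0 : 0ℚ ℚ.< μ) (κ>0 : 0ℚ ℚ.< κ) (Kκ≡μ : 3ℚ ℚ.* cast B ℚ.* κ ≡ μ) where

  open Adversary B k
  open Run ALG

  δ : ℚ
  δ = proj₁ c>0

  δ>0 : 0ℚ ℚ.< δ
  δ>0 = proj₁ (proj₂ c>0)

  β = cast B
  v : Fin m → ℕ → ℚ
  v i n = seq (value α i) n
  r : ℕ → ℚ
  r n = seq (recipᵣ c c>0) n

  a≥0 : Eventually (λ n → 0ℚ ℚ.≤ v top n)
  a≥0 = eventually-nonNeg (value α zero) (value α top) (lowest α) (monotone α zero top ℕ.z≤n)

  u≈1 : Eventually (λ n → ∣ v zero n ℚ.- 1ℚ ∣ ℚ.≤ κ)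
  u≈1 = lowest α κ κ>0

  Game : Fin m → Fin m → ℕ → Set
  Game q q′ n = let S = β ℚ.* (v zero n ℚ.+ v top n ℚ.+ v q n ℚ.+ v q′ n) in
    S ℚ.* r n ℚ.≤ S ℚ.- cast (load opening q) ℚ.* v q n ℚ.- cast (load (middle q) q′) ℚ.* v q′ n ℚ.+ 3ℚ ℚ.* β ℚ.* κ

  game : ∀ q q′ → Eventually (Game q q′)
  game q q′ = map-eventually
    (λ n → subst₂ ℚ._≤_ (cong (ℚ._* r n) (gain-optimal α n q q′)) (cong₂ ℚ._+_ (gain-input ALG α n q q′) (sym Kκ≡μ)))
    (≤ᵣ⇒eventually {gain α (optimal q q′) (input q q′) ÷ c ⟨ c>0 ⟩} {gain α ALG (input q q′)}
      (competitive (input q q′) (input-admissible q q′) (optimal q q′) (optimal-isOptimal α q q′)) μ μ>0)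

  s : ℕ → ℚ
  s n = seq (recipᵣ (denominator (value α top)) (denominator>0 α)) n

  -- The terms of `recipᵣ` are reciprocals of clamped terms, so they invert those of `c` only once
  -- the recorded lower bound `δ` holds.
  c-inverse : ∀ n → 0ℚ ℚ.+ δ ℚ.≤ seq c n → seq c n ℚ.* r n ≡ 1ℚ
  c-inverse n c≥δ = recip-clamped (⊔-pos (seq c n) δ δ>0) (subst (ℚ._≤ seq c n) (ℚ.+-identityˡ δ) c≥δ)

  denominator-inverse : ∀ n → 0ℚ ℚ.≤ v top n → den (v top n) ℚ.* s n ≡ 1ℚ
  denominator-inverse n a≥0 = trans (cong (ℚ._* s n) (sym (seq-denominator (value α top) n)))
    -- `1ℚ` is the lower bound recorded by `denominator>0`, and `1≤den` shows that the clamp is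
    -- inactive.
    (recip-clamped (⊔-pos (seq (denominator (value α top)) n) 1ℚ 0<1)
      (subst (1ℚ ℚ.≤_) (sym (seq-denominator (value α top) n)) (1≤den a≥0)))

  s≥0 : ∀ n → 0ℚ ℚ.≤ s n
  s≥0 n = ℚ.<⇒≤ (recip-pos (seq (denominator (value α top)) n ℚ.⊔ 1ℚ) (⊔-pos (seq (denominator (value α top)) n) 1ℚ 0<1))

  seq-bound : ∀ n → seq (bound α) n ≡ 1ℚ ℚ.+ num (v top n) ℚ.* s n
  seq-bound n = cong (λ N → 1ℚ ℚ.+ N ℚ.* s n) (seq-numerator (value α top) n)

  refute : ∀ n → 0ℚ ℚ.+ δ ℚ.≤ seq c n → seq c n ℚ.+ 8ℚ ℚ.* μ ℚ.≤ seq (bound α) n → 0ℚ ℚ.≤ v top n →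
    ∣ v zero n ℚ.- 1ℚ ∣ ℚ.≤ κ → Game zero zero n → Game zero top n → Game top top n → Game top zero n → ⊥
  refute n c≥δ c+ε≤bound a≥0 u≈1 G₀₀ G₀ₜ Gₜₜ Gₜ₀ =
    games-incompatible {v top n} {v zero n} {seq c n} {r n} {s n} {β} {κ}
      {cast (load opening zero)} {cast (load opening top)} {cast (load (middle zero) zero)}
      {cast (load (middle zero) top)} {cast (load (middle top) zero)} {cast (load (middle top) top)}
      (trans (cong cast (sym (load-opening ALG))) (cast-+ (load opening zero) (load opening top)))
      (trans (cong cast (sym (load-middle-zero ALG))) (cast-+ (load (middle zero) zero) (load (middle zero) top)))
      (trans (cong cast (sym (load-middle-top ALG))) (cast-+ (load (middle top) zero) (load (middle top) top)))
      (cast≥0 (load (middle zero) zero)) (cast≥0 (load (middle zero) top))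
      (cast≥0 (load (middle top) zero)) (cast≥0 (load (middle top) top))
      (cast-mono {1} {B} 1≤B) a≥0
      (ℚ.≤-trans (ℚ.<⇒≤ δ>0) (subst (ℚ._≤ seq c n) (ℚ.+-identityˡ δ) c≥δ))
      (c-inverse n c≥δ) (s≥0 n) (denominator-inverse n a≥0) κ>0
      (absdiff-lower (v zero n) 1ℚ κ u≈1)
      (absdiff-lower 1ℚ (v zero n) κ (subst (ℚ._≤ κ) (∣p-q∣≡∣q-p∣ (v zero n) 1ℚ) u≈1))
      (subst₂ (λ μ x → seq c n ℚ.+ 8ℚ ℚ.* μ ℚ.≤ x) (sym Kκ≡μ) (seq-bound n) c+ε≤bound)
      G₀₀ G₀ₜ Gₜₜ Gₜ₀

  -- All eight facts hold from some common index on, and the rational contradiction at that one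
  -- index is enough.
  bound-not-above : ¬ Eventually (λ n → seq c n ℚ.+ 8ℚ ℚ.* μ ℚ.≤ seq (bound α) n)
  bound-not-above above = clash
    (proj₂ (proj₂ c>0) and above and a≥0 and u≈1 and game zero zero and game zero top and game top top and game top zero)
    where
    clash : ¬ Eventually (λ n → 0ℚ ℚ.+ δ ℚ.≤ seq c n × seq c n ℚ.+ 8ℚ ℚ.* μ ℚ.≤ seq (bound α) n × 0ℚ ℚ.≤ v top n ×
      ∣ v zero n ℚ.- 1ℚ ∣ ℚ.≤ κ × Game zero zero n × Game zero top n × Game top top n × Game top zero n)
    clash (N , holds) =
      let c≥δ , c+ε≤bound , a≥0 , u≈1 , G₀₀ , G₀ₜ , Gₜₜ , Gₜ₀ = holds N ℕ.≤-refl
      in refute N c≥δ c+ε≤bound a≥0 u≈1 G₀₀ G₀ₜ Gₜₜ Gₜ₀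

-- `≤ᵣ` negates `<ᵣ`, so a gap `ε` between `c` and the bound is given. It is cut into eight parts
-- `μ`, more than the five that the error terms consume, and `κ` is then chosen to make those errors
-- multiples of `μ`.
bound≤competitive : ∀ {B k} → 1 ℕ.≤ B → (α : PriorityValues k) (ALG : OnlineAlgorithm (2 ℕ.+ k) B) →
  IsLowerBound (Competitive α ALG) (bound α)
bound≤competitive {B} 1≤B α ALG c (c>0 , competitive) (ε , ε>0 , M , c+ε≤bound) =
  let μ , μ>0 , 8μ≡ε = divide 8ℚ ε (ℚ.positive⁻¹ 8ℚ) ε>0
      κ , κ>0 , Kκ≡μ = divide (3ℚ ℚ.* cast B) μ K>0 μ>0
  in LowerBound.bound-not-above 1≤B α ALG c c>0 competitive μ κ μ>0 κ>0 Kκ≡μ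
       (M , λ n M≤n → subst (λ ε → seq c n ℚ.+ ε ℚ.≤ seq (bound α) n) (sym 8μ≡ε) (c+ε≤bound n M≤n))
  where
  K>0 : 0ℚ ℚ.< 3ℚ ℚ.* cast B
  K>0 = ℚ-*-pos (ℚ.positive⁻¹ 3ℚ) (ℚ.<-≤-trans 0<1 (cast-mono {1} {B} 1≤B))

theorem4p1 : ∀ (B k : ℕ) → 1 ≤ B →
    (α : PriorityValues k) (ALG : OnlineAlgorithm (2 + k) B) →
    (∀ c → Competitive α ALG c → bound α ≤ᵣ c) ×
    (∀ ρ → IsCompetitiveRatio α ALG ρ → bound α ≤ᵣ ρ)
theorem4p1 B k 1≤B α ALG = competitive , λ ρ infimum → proj₂ infimum (bound α) competitive
  where
  competitive : IsLowerBound (Competitive α ALG) (bound α)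
  competitive = bound≤competitive 1≤B α ALG
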